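{- Let $W$ be an even positive integer with $W/2>d$. For every fixed finite sequence of virtual addresses to be translated, $$\mathrm{MIN}(W)\le \mathrm{ISMIN}(W)\le \mathrm{ISLRU}(W)\le \mathrm{LRU}(W)\le 2\,\mathrm{MIN}(W/2),$$ where, for a replacement strategy $A$ and a size $s>d$, $A(s)$ denotes the number of insertions performed by $A$ into an initially empty translation cache of size $s$ when serving the given sequence of translations.
   Context: Fix integers $K\ge 2$, $P\ge 1$, $d\ge 1$. The translation tree is the $K$-ary tree of height $d$ with nodes $(\ell,i)$, $0\le \ell\le d$, $0\le i<K^{d-\ell}$; $\ell$ is the layer of the node. A node $(\ell,i)$ with $\ell\ge1$ has the children $(\ell-1,Ki+a)$, $a=0,\dots,K-1$; the root is $(d,0)$; the leaves, on layer $0$, are the data pages. A virtual address is an integer $\alpha\in[0,K^dP-1]$; its translation path is $v_d,v_{d-1},\dots,v_0$ with $v_\ell=(\ell,\lfloor \alpha/(PK^\ell)\rfloor)$. A translation cache (TC) of size $W$ stores at most $W$ nodes of the tree; its content is changed by insertions and evictions of single nodes. Translating an address requires accessing all nodes of its translation path in the order $v_d,\dots,v_0$; a node can be accessed only while it is in the TC. A replacement strategy decides which nodes are inserted and evicted, and when, while serving a sequence of translations (it may depend on the whole sequence). A strategy is lazy if it inserts a missing node only when that node is accessed directly after the insertion, and evicts a node only immediately before an insertion for which there would otherwise be no free cell; otherwise it is eager. An initial segment of a rooted tree is the empty tree or a connected subgraph containing the root. A strategy has the initial segment property (ISP) if the TC content is an initial segment of the translation tree at all times. All four strategies below are lazy,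 so they are determined by which node they evict when an eviction is necessary. MIN: an optimal replacement strategy (fewest insertions), realized by always evicting a node whose next access is furthest in the future. LRU: evicts the least recently accessed node. ISLRU: evicts the lowest descendant in the TC (possibly the node itself) of the least recently accessed node. ISMIN: among the nodes in the TC that are not on the current translation path and have no descendants in the TC, evicts the one that is not used for the longest time into the future; nodes that will never be used again are evicted before the others, in arbitrary descendant-first order. -}

module Defs where

open import Data.Bool.Base using (if_then_else_)
open import Data.Fin.Base using (Fin; toℕ; opposite)
open import Data.Fin.Properties using (toℕ<n)
open import Data.List.Base using (List; []; _∷_; length; map; concatMap; filter; takeWhile; tabulate)
open import Data.List.Membership.Propositional using (_∈_; _∉_)
open import Data.Nat.Base
open import Data.Nat.DivMod using (_/_; m<n*o⇒m/o<n)
open import Data.Nat.Properties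
open import Data.Product.Base using (∃; _×_; _,_; proj₂)
open import Function.Base using (_∘_)
open import Level using (0ℓ)
open import Relation.Binary.Construct.Closure.ReflexiveTransitive using (Star)
open import Relation.Binary.Construct.Closure.Transitive using (TransClosure)
open import Relation.Binary.Core using (Rel)
open import Relation.Binary.Definitions using (DecidableEquality)
open import Relation.Binary.PropositionalEquality
open import Relation.Nullary.Decidable.Core using (yes; no; does; ¬?)
open import Relation.Nullary.Negation.Core using (¬_)
open import Relation.Unary using (Pred)

module Translation (K P d : ℕ) (K≥2 : 2 ≤ K) (P≥1 : 1 ≤ P) where

  spanNonZero : ∀ ℓ → NonZero (P * K ^ ℓ)
  spanNonZero ℓ = m*n≢0 P (K ^ ℓ) {{>-nonZero P≥1}} {{m^n≢0 K ℓ {{>-nonZero (<⇒≤ K≥2)}}}}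

  record Node : Set where
    constructor node
    field
      layer    : ℕ
      index    : ℕ
      .layer≤d : layer ≤ d
      .index<  : index < K ^ (d ∸ layer)

  open Node public

  _≟ᴺ_ : DecidableEquality Node
  node ℓ i _ _ ≟ᴺ node m j _ _ with ℓ ≟ m | i ≟ j
  ... | yes refl | yes refl = yes refl
  ... | no  ℓ≢m  | _        = no λ { refl → ℓ≢m refl }
  ... | yes _    | no i≢j   = no λ { refl → i≢j refl }

  open import Data.List.Membership.DecPropositional _≟ᴺ_ using (_∈?_)

  -- c ◁ p : c is a child of p.
  _◁_ : Rel Node 0ℓ
  c ◁ p = layer p ≡ suc (layer c) × ∃ λ (a : Fin K) → index c ≡ K * index p + toℕ a

  ProperDescendant : Rel Node 0ℓ
  ProperDescendant = TransClosure _◁_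

  DescendantOrSelf : Rel Node 0ℓ
  DescendantOrSelf = Star _◁_

  Address : Set
  Address = Fin (K ^ d * P)

  pathIndex : Address → ℕ → ℕ
  pathIndex α ℓ = _/_ (toℕ α) (P * K ^ ℓ) {{spanNonZero ℓ}}

  pathIndex-bound : ∀ (α : Address) {ℓ} → ℓ ≤ d → pathIndex α ℓ < K ^ (d ∸ ℓ)
  pathIndex-bound α {ℓ} ℓ≤d =
    m<n*o⇒m/o<n {n = K ^ (d ∸ ℓ)} {{spanNonZero ℓ}} (subst (toℕ α <_) split (toℕ<n α))
    where
    open ≡-Reasoning
    split : K ^ d * P ≡ K ^ (d ∸ ℓ) * (P * K ^ ℓ)
    split = begin
      K ^ d * P                   ≡⟨ cong (λ e → K ^ e * P) (m∸n+n≡m ℓ≤d) ⟨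
      K ^ (d ∸ ℓ + ℓ) * P         ≡⟨ cong (_* P) (^-distribˡ-+-* K (d ∸ ℓ) ℓ) ⟩
      K ^ (d ∸ ℓ) * K ^ ℓ * P     ≡⟨ *-assoc (K ^ (d ∸ ℓ)) (K ^ ℓ) P ⟩
      K ^ (d ∸ ℓ) * (K ^ ℓ * P)   ≡⟨ cong (K ^ (d ∸ ℓ) *_) (*-comm (K ^ ℓ) P) ⟩
      K ^ (d ∸ ℓ) * (P * K ^ ℓ)   ∎

  pathNode : Address → Fin (suc d) → Node
  pathNode α ℓ = node (toℕ ℓ) (pathIndex α (toℕ ℓ)) ℓ≤d (pathIndex-bound α ℓ≤d)
    where
    ℓ≤d : toℕ ℓ ≤ d
    ℓ≤d = s≤s⁻¹ (toℕ<n ℓ)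

  -- From the root down: opposite sends the position k to the layer d ∸ k.
  path : Address → List Node
  path α = tabulate (pathNode α ∘ opposite)

  -- Node accesses, each tagged with the address being translated.
  Request : Set
  Request = Address × Node

  requests : List Address → List Request
  requests = concatMap λ α → map (α ,_) (path α)

  -- The moment at which a lazy strategy has to evict.
  record Situation : Set where
    field
      past    : List Node   -- completed accesses, latest first
      content : List Node   -- nodes in the cache
      address : Address     -- address being translated
      future  : List Node   -- remaining accesses, starting with the missing node

  open Situation public

  -- A lazy strategy is determined by its choice of the victim.
  Policy : Set
  Policy = Situation → Node

  makeRoom : Policy → ℕ → Situation → List Node
  makeRoom π s σ =
    if does (length (content σ) <? s)
    then content σ
    else filter (¬? ∘ (π σ ≟ᴺ_)) (content σ)

  -- Number of insertions while serving the given requests, started with the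
  -- given past accesses and cache content.
  insertionsFrom : Policy → ℕ → List Node → List Node → List Request → ℕ
  insertionsFrom π s past C []               = 0
  insertionsFrom π s past C ((α , v) ∷ rest) with v ∈? C
  ... | yes _ = insertionsFrom π s (v ∷ past) C rest
  ... | no  _ = suc (insertionsFrom π s (v ∷ past) (v ∷ makeRoom π s σ) rest)
    where
    σ : Situation
    σ = record { past = past ; content = C ; address = α ; future = v ∷ map proj₂ rest }

  insertions : Policy → ℕ → List Address → ℕ
  insertions π s αs = insertionsFrom π s [] [] (requests αs)

  -- Position of the first occurrence of v.  If there is none, this is the length
  -- of the list, which exceeds every position: "never" is later than any access.
  delay : Node → List Node → ℕ
  delay v = length ∘ takeWhile (¬? ∘ (v ≟ᴺ_))

  Maximal : (Node → ℕ) → Pred Node 0ℓ → Pred Node 0ℓ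
  Maximal f Q w = Q w × (∀ u → Q u → f u ≤ f w)

  Minimal : (Node → ℕ) → Pred Node 0ℓ → Pred Node 0ℓ
  Minimal f Q w = Q w × (∀ u → Q u → f w ≤ f u)

  InCache : Situation → Pred Node 0ℓ
  InCache σ w = w ∈ content σ

  FurthestInFuture : Situation → Pred Node 0ℓ → Pred Node 0ℓ
  FurthestInFuture σ = Maximal λ w → delay w (future σ)

  LeastRecentlyAccessed : Situation → Pred Node 0ℓ
  LeastRecentlyAccessed σ = Maximal (λ w → delay w (past σ)) (InCache σ)

  -- The strategies below are specified by the victims they may choose, so that
  -- ties can be broken in any way.  The nonemptiness premises exclude only
  -- situations that never cause an eviction; for ISMIN this uses that the cache
  -- has more than d cells, so that a full cache always contains a candidate.

  -- That this rule minimises the number of insertions is not built in.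
  IsMIN : Pred Policy 0ℓ
  IsMIN π = ∀ σ → ∃ (InCache σ) → FurthestInFuture σ (InCache σ) (π σ)

  IsLRU : Pred Policy 0ℓ
  IsLRU π = ∀ σ → ∃ (InCache σ) → LeastRecentlyAccessed σ (π σ)

  IsISLRU : Pred Policy 0ℓ
  IsISLRU π = ∀ σ → ∃ (InCache σ) →
    ∃ λ x → LeastRecentlyAccessed σ x ×
            Minimal layer (λ w → InCache σ w × DescendantOrSelf w x) (π σ)

  ISMINCandidate : Situation → Pred Node 0ℓ
  ISMINCandidate σ w =
    InCache σ w ×
    w ∉ path (address σ) ×
    ¬ (∃ λ u → InCache σ u × ProperDescendant u w)

  -- Nodes that are never used again come first because of the value of delay,
  -- and in descendant-first order because candidates have no cached descendants.
  IsISMIN : Pred Policy 0ℓ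
  IsISMIN π = ∀ σ → ∃ (ISMINCandidate σ) → FurthestInFuture σ (ISMINCandidate σ) (π σ)

{-# OPTIONS --safe #-}
module Submission where

-- MIN and ISMIN: compare a cache M serving the requests with a rival cache C.
-- If for every t at most k more nodes of C than of M are needed within the next
-- t accesses, then M makes at most k insertions more than C from now on.  An
-- eviction preserves this when the victim is the node of M needed last, except
-- that nodes C is bound to keep need not be considered.  For ISMIN against ISLRU
-- these are the nodes already accessed in the current translation.
--
-- ISLRU is LRU for the history in which every completed path is listed root
-- first.  The two caches therefore differ, between translations, only by the end
-- of one path from which nodes were dropped, and since ISLRU keeps the top of
-- that path it misses no more nodes of the next path than LRU does.
--
-- LRU against MIN: split the requests into phases of W distinct nodes.  LRU never
-- misses a node twice in a phase, and a cache of half the size holds at most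
-- W/2 − 1 of the nodes that are new in the phase when it begins.  The deficit of
-- an incomplete last phase is paid for by the first phase, which starts empty.

open import Defs
open import Data.Nat using (ℕ; _≤_; _<_; _*_; _/_)
open import Data.Nat.Divisibility using (_∣_)
open import Data.List using (List)
open import Data.Product using (_×_)
open import Data.Fin using (Fin; zero; suc; toℕ; fromℕ<; opposite)
open import Data.Fin.Properties using (toℕ<n; toℕ-injective; toℕ-fromℕ<; opposite-prop; opposite-involutive)
  renaming (suc-injective to Fin-suc-injective)
open import Data.List using ([]; _∷_; _++_; [_]; length; map; filter; reverse; _ʳ++_; concatMap; tabulate; takeWhile)
open import Data.List.Properties
open import Data.List.Membership.Propositional using (_∈_; _∉_; find; lose)
open import Data.List.Membership.Propositional.Properties
open import Data.List.Relation.Binary.Permutation.Propositional using (_↭_; ↭-refl; ↭-sym; ↭-trans; prep; swap)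
open import Data.List.Relation.Binary.Permutation.Propositional.Properties using (∈-resp-↭; ↭-length; filter-↭; shift; ↭-reverse)
open import Data.List.Relation.Binary.Subset.Propositional using (_⊆_)
open import Data.List.Relation.Unary.All as All using (All; []; _∷_)
open import Data.List.Relation.Unary.Any as Any using (here; there; any?)
open import Data.List.Relation.Unary.Unique.Propositional using (Unique; []; _∷_)
import Data.List.Relation.Unary.Unique.Propositional.Properties as Unique
open import Data.Nat using (zero; suc; _+_; _∸_; _^_; NonZero; >-nonZero; z≤n; s≤s; s≤s⁻¹; _≤?_; _<?_)
import Data.Nat.DivMod as DivMod
open import Data.Nat.Properties hiding (_≟_)
open import Data.Nat.Divisibility using (divides)
open import Data.Nat.Solver using (module +-*-Solver)
open import Data.Product using (∃; ∃₂; _,_; proj₁; proj₂)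
open import Data.Sum as Sum using (_⊎_; inj₁; inj₂)
open import Data.List.Extrema ≤-totalOrder using (argmin; argmin-all; f[argmin]≤f[xs])
open import Function using (_∘_; id; case_of_)
open import Level using (0ℓ)
open import Relation.Binary.Definitions using (DecidableEquality)
open import Relation.Binary.Construct.Closure.ReflexiveTransitive using (ε; _◅_)
import Relation.Binary.Construct.Closure.Transitive as TC
open import Relation.Binary.PropositionalEquality hiding ([_])
open import Relation.Nullary using (¬_; Dec; yes; no; ¬?; contradiction; recompute)
open import Relation.Nullary.Decidable using (_×-dec_; dec-true; dec-false)
open import Relation.Unary using (Pred; Decidable)

-- Counting in lists without repetitions

module _ {A : Set} where

  unique-⊆⇒length-≤ : ∀ {xs ys : List A} → Unique xs → xs ⊆ ys → length xs ≤ length ys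
  unique-⊆⇒length-≤ [] _ = z≤n
  unique-⊆⇒length-≤ {x ∷ xs} (x≢ ∷ u) xs⊆ with ∈-∃++ (xs⊆ (here refl))
  ... | as , bs , refl = begin
    suc (length xs)           ≤⟨ s≤s (unique-⊆⇒length-≤ u xs⊆rest) ⟩
    suc (length (as ++ bs))   ≡⟨ ↭-length (shift x as bs) ⟨
    length (as ++ x ∷ bs)     ∎
    where
    open ≤-Reasoning
    xs⊆rest : xs ⊆ as ++ bs
    xs⊆rest y∈ with ∈-resp-↭ (shift x as bs) (xs⊆ (there y∈))
    ... | here refl = contradiction refl (All.lookup x≢ y∈)
    ... | there y∈′ = y∈′

  count-≤ : ∀ {P Q : Pred A 0ℓ} (P? : Decidable P) (Q? : Decidable Q) {xs ys} → Unique xs →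
            (∀ {x} → x ∈ xs → P x → x ∈ ys × Q x) →
            length (filter P? xs) ≤ length (filter Q? ys)
  count-≤ P? Q? u imp = unique-⊆⇒length-≤ (Unique.filter⁺ P? u) λ x∈ →
    let x∈xs , px = ∈-filter⁻ P? x∈
        x∈ys , qx = imp x∈xs px
    in ∈-filter⁺ Q? x∈ys qx

  filter-complement : ∀ {P : Pred A 0ℓ} (P? : Decidable P) xs →
                      length (filter P? xs) + length (filter (¬? ∘ P?) xs) ≡ length xs
  filter-complement P? [] = refl
  filter-complement P? (x ∷ xs) with P? x
  ... | yes _ = cong suc (filter-complement P? xs)
  ... | no _  = trans (+-suc _ _) (cong suc (filter-complement P? xs))

  module _ (_≟_ : DecidableEquality A) where

    open import Data.List.Membership.DecPropositional _≟_ using (_∈?_)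

    pigeonhole : ∀ {xs ys : List A} → Unique xs → length ys < length xs → ∃ λ x → x ∈ xs × x ∉ ys
    pigeonhole {xs} {ys} u ys<xs with any? (¬? ∘ (_∈? ys)) xs
    ... | yes some = find some
    ... | no none  = contradiction (unique-⊆⇒length-≤ u xs⊆ys) (<⇒≱ ys<xs)
      where
      xs⊆ys : xs ⊆ ys
      xs⊆ys {x} x∈ with x ∈? ys
      ... | yes x∈ys = x∈ys
      ... | no x∉ys  = contradiction (lose x∈ x∉ys) none

-- Caches as lists, waiting times and single requests

module Paging {A : Set} (_≟_ : DecidableEquality A) where

  open import Data.List.Membership.DecPropositional _≟_ using (_∈?_)

  infixl 6 _─_
  _─_ : List A → A → List A
  C ─ z = filter (¬? ∘ (z ≟_)) C

  -- On a list of future accesses this is a waiting time. On a list of past accesses, latest first,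
  -- it is an age.
  delay : A → List A → ℕ
  delay v = length ∘ takeWhile (¬? ∘ (v ≟_))

  private variable
    u v w x y z : A
    C C′ h xs ys : List A
    n s : ℕ
    V : A → Set

  ─-⊆ : C ─ z ⊆ C
  ─-⊆ {z = z} = proj₁ ∘ ∈-filter⁻ (¬? ∘ (z ≟_))

  ∈-─⁺ : x ∈ C → z ≢ x → x ∈ C ─ z
  ∈-─⁺ {z = z} = ∈-filter⁺ (¬? ∘ (z ≟_))

  z∉─ : z ∉ C ─ z
  z∉─ {z = z} {C} z∈ = proj₂ (∈-filter⁻ (¬? ∘ (z ≟_)) {xs = C} z∈) refl

  ─-unique : Unique C → Unique (C ─ z)
  ─-unique {z = z} = Unique.filter⁺ (¬? ∘ (z ≟_))

  ─-↭ : Unique C → z ∈ C → C ↭ z ∷ (C ─ z)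
  ─-↭ {x ∷ xs} {z} (x≢ ∷ u) z∈ with z ≟ x | z∈
  ... | yes refl | _ = prep z (subst (xs ↭_) (sym (filter-all (¬? ∘ (z ≟_)) x≢)) ↭-refl)
  ... | no z≢x | here z≡x = contradiction z≡x z≢x
  ... | no z≢x | there z∈xs = ↭-trans (prep x (─-↭ u z∈xs)) (swap x z ↭-refl)

  ─-length : Unique C → z ∈ C → length C ≡ suc (length (C ─ z))
  ─-length u z∈ = ↭-length (─-↭ u z∈)

  ─-shorter : z ∈ C → length (C ─ z) < length C
  ─-shorter {z = z} {C} z∈ = filter-notAll (¬? ∘ (z ≟_)) C (Any.map (λ z≡x z≢x → z≢x z≡x) z∈)

  delay-here : ∀ v xs → delay v (v ∷ xs) ≡ 0
  delay-here v _ with v ≟ v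
  ... | yes _ = refl
  ... | no v≢v = contradiction refl v≢v

  delay-there : v ≢ x → delay v (x ∷ xs) ≡ suc (delay v xs)
  delay-there {v} {x} v≢x with v ≟ x
  ... | yes v≡x = contradiction v≡x v≢x
  ... | no _    = refl

  delay-++-∈ : v ∈ xs → delay v (xs ++ ys) ≡ delay v xs
  delay-++-∈ {v} {x ∷ xs} v∈ with v ≟ x | v∈
  ... | yes _  | _          = refl
  ... | no v≢x | here v≡x   = contradiction v≡x v≢x
  ... | no _   | there v∈xs = cong suc (delay-++-∈ v∈xs)

  delay-++-∉ : v ∉ xs → delay v (xs ++ ys) ≡ length xs + delay v ys
  delay-++-∉ {xs = []} _ = refl
  delay-++-∉ {xs = x ∷ xs} v∉ =
    trans (delay-there (v∉ ∘ here)) (cong suc (delay-++-∉ (v∉ ∘ there)))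

  delay-∈ : v ∈ xs → delay v xs < length xs
  delay-∈ {v} {x ∷ xs} v∈ with v ≟ x | v∈
  ... | yes _  | _          = s≤s z≤n
  ... | no v≢x | here v≡x   = contradiction v≡x v≢x
  ... | no _   | there v∈xs = s≤s (delay-∈ v∈xs)

  delay-++-< : u ∈ xs → w ∉ xs → delay u (xs ++ ys) < delay w (xs ++ ys)
  delay-++-< {u} {xs} {w} {ys} u∈ w∉ = begin-strict
    delay u (xs ++ ys)      ≡⟨ delay-++-∈ u∈ ⟩
    delay u xs              <⟨ delay-∈ u∈ ⟩
    length xs               ≤⟨ m≤m+n _ _ ⟩
    length xs + delay w ys  ≡⟨ delay-++-∉ w∉ ⟨
    delay w (xs ++ ys)      ∎
    where open ≤-Reasoning

  delay-++-mono : u ∉ xs → w ∉ xs → delay u ys ≤ delay w ys → delay u (xs ++ ys) ≤ delay w (xs ++ ys)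
  delay-++-mono {u} {xs} {w} u∉ w∉ le =
    subst₂ _≤_ (sym (delay-++-∉ u∉)) (sym (delay-++-∉ w∉)) (+-monoʳ-≤ (length xs) le)

  delay-++-mono⁻ : u ∉ xs → w ∉ xs → delay u (xs ++ ys) ≤ delay w (xs ++ ys) → delay u ys ≤ delay w ys
  delay-++-mono⁻ {u} {xs} {w} u∉ w∉ le =
    +-cancelˡ-≤ (length xs) _ _ (subst₂ _≤_ (delay-++-∉ u∉) (delay-++-∉ w∉) le)

  delay-injective : u ∈ xs → delay u xs ≡ delay w xs → u ≡ w
  delay-injective {u} {x ∷ xs} {w} u∈ eq with u ≟ x | w ≟ x | u∈
  ... | yes u≡x | yes w≡x | _ = trans u≡x (sym w≡x)
  ... | no u≢x | _ | here u≡x = contradiction u≡x u≢x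
  ... | no _ | no _ | there u∈xs = delay-injective u∈xs (suc-injective eq)

  delay-reverse : Unique xs → u ∈ xs → delay u (reverse xs) + suc (delay u xs) ≡ length xs
  delay-reverse {x ∷ xs} {u} (x≢ ∷ uq) u∈ rewrite unfold-reverse x xs with u ≟ x | u∈
  ... | no u≢x | here u≡x = contradiction u≡x u≢x
  ... | yes refl | _ = begin
      delay u (reverse xs ++ [ u ]) + 1         ≡⟨ +-comm _ 1 ⟩
      suc (delay u (reverse xs ++ [ u ]))       ≡⟨ cong suc (delay-++-∉ u∉) ⟩
      suc (length (reverse xs) + delay u [ u ]) ≡⟨ cong suc (cong₂ _+_ (length-reverse xs) (delay-here u [])) ⟩
      suc (length xs + 0)                       ≡⟨ cong suc (+-identityʳ _) ⟩
      suc (length xs)                           ∎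
    where
    open ≡-Reasoning
    u∉ : u ∉ reverse xs
    u∉ u∈ = All.lookup x≢ (∈-resp-↭ (↭-reverse xs) u∈) refl
  ... | no _ | there u∈xs = begin
      delay u (reverse xs ++ [ x ]) + suc (suc (delay u xs)) ≡⟨ cong (_+ _) (delay-++-∈ (∈-resp-↭ (↭-sym (↭-reverse xs)) u∈xs)) ⟩
      delay u (reverse xs) + suc (suc (delay u xs))          ≡⟨ +-suc _ _ ⟩
      suc (delay u (reverse xs) + suc (delay u xs))          ≡⟨ cong suc (delay-reverse uq u∈xs) ⟩
      suc (length xs)                                        ∎
    where open ≡-Reasoning

  -- The replacement rule enters only through `V`, the victims it allows, so that each argument can
  -- state exactly what it has to know about a victim. The last index counts insertions.
  data Step (s : ℕ) (v : A) (V : A → Set) (C : List A) : List A → ℕ → Set where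
    hit   : v ∈ C → Step s v V C C 0
    free  : v ∉ C → length C < s → Step s v V C (v ∷ C) 1
    evict : ∀ z → v ∉ C → s ≤ length C → V z → Step s v V C (v ∷ (C ─ z)) 1

  step-weaken : ∀ {V V′ : A → Set} → (∀ {z} → V z → V′ z) → Step s v V C C′ n → Step s v V′ C C′ n
  step-weaken _ (hit v∈)           = hit v∈
  step-weaken _ (free v∉ lt)       = free v∉ lt
  step-weaken f (evict z v∉ le vz) = evict z v∉ le (f vz)

  v∈step : Step s v V C C′ n → v ∈ C′
  v∈step (hit v∈C)       = v∈C
  v∈step (free _ _)      = here refl
  v∈step (evict _ _ _ _) = here refl

  step-⊆ : Step s v V C C′ n → C′ ⊆ v ∷ C
  step-⊆ (hit _)         x∈         = there x∈
  step-⊆ (free _ _)      x∈         = x∈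
  step-⊆ (evict _ _ _ _) (here eq)  = here eq
  step-⊆ (evict _ _ _ _) (there x∈) = there (─-⊆ x∈)

  step-survives : Step s v V C C′ n → x ∈ C → (v ∉ C → s ≤ length C → ¬ V x) → x ∈ C′
  step-survives (hit _)              x∈ _    = x∈
  step-survives (free _ _)           x∈ _    = there x∈
  step-survives (evict _ v∉ full vz) x∈ safe = there (∈-─⁺ x∈ λ { refl → safe v∉ full vz })

  step-unique : Step s v V C C′ n → Unique C → Unique C′
  step-unique (hit _) u = u
  step-unique {C = C} (free v∉C _) u = All.tabulate (λ { x∈ refl → v∉C x∈ }) ∷ u
  step-unique (evict _ v∉C _ _) u = All.tabulate (λ { x∈ refl → v∉C (─-⊆ x∈) }) ∷ ─-unique u

  step-length : Step s v V C C′ n → (∀ {z} → V z → z ∈ C) → Unique C → length C ≤ s → length C′ ≤ s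
  step-length (hit _) _ _ le = le
  step-length (free _ lt) _ _ _ = lt
  step-length (evict z _ _ vz) V⊆ u le = ≤-trans (≤-reflexive (sym (─-length u (V⊆ vz)))) le

  -- Belady's exchange argument

  within : ℕ → List A → List A → ℕ
  within t F C = length (filter (λ x → delay x F ≤? t) C)

  within-↭ : ∀ t F {C D} → C ↭ D → within t F C ≡ within t F D
  within-↭ t F C↭D = ↭-length (filter-↭ (λ x → delay x F ≤? t) C↭D)

  within-∷ : ∀ t F x C → within t F (x ∷ C) ≡ within t F [ x ] + within t F C
  within-∷ t F x C = trans (cong length (filter-++ P? [ x ] C)) (length-++ (filter P? [ x ]))
    where
    P? : Decidable λ x → delay x F ≤ t
    P? x = delay x F ≤? t

  within-shift : ∀ t F → Unique C → v ∉ C → within (suc t) (v ∷ F) C ≡ within t F C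
  within-shift {C} {v} t F u v∉C = ≤-antisym
    (count-≤ (λ x → delay x (v ∷ F) ≤? suc t) (λ x → delay x F ≤? t) u
      λ x∈ le → x∈ , s≤s⁻¹ (subst (_≤ suc t) (delay-there λ { refl → v∉C x∈ }) le))
    (count-≤ (λ x → delay x F ≤? t) (λ x → delay x (v ∷ F) ≤? suc t) u
      λ x∈ le → x∈ , subst (_≤ suc t) (sym (delay-there λ { refl → v∉C x∈ })) (s≤s le))

  within-first : ∀ t F v → within t (v ∷ F) [ v ] ≡ 1
  within-first t F v =
    cong length (filter-accept (λ x → delay x (v ∷ F) ≤? t) {v} {[]} (subst (_≤ t) (sym (delay-here v F)) z≤n))

  -- The access moves `v` from position 0 to its next occurrence, and `within t F [ v ]` tells
  -- whether that is within `t`. The correction is the same for every cache and cancels when two are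
  -- compared.
  within-hit : ∀ t F → Unique C → v ∈ C →
               within t F C + 1 ≡ within (suc t) (v ∷ F) C + within t F [ v ]
  within-hit {C} {v} t F u v∈ = begin
    within t F C + 1                   ≡⟨ cong (_+ 1) (split t F) ⟩
    e + p + 1                          ≡⟨ solve 2 (λ e p → e :+ p :+ con 1 := con 1 :+ p :+ e) refl e p ⟩
    1 + p + e                          ≡⟨ cong (_+ e) (cong₂ _+_ (within-first (suc t) F v)
                                                                (within-shift t F (─-unique u) (z∉─ {C = C}))) ⟨
    within (suc t) (v ∷ F) [ v ] + within (suc t) (v ∷ F) (C ─ v) + e ≡⟨ cong (_+ e) (split (suc t) (v ∷ F)) ⟨
    within (suc t) (v ∷ F) C + e       ∎
    where
    open ≡-Reasoning
    open +-*-Solver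
    e p : ℕ
    e = within t F [ v ]
    p = within t F (C ─ v)
    split : ∀ t F → within t F C ≡ within t F [ v ] + within t F (C ─ v)
    split t F = trans (within-↭ t F (─-↭ u v∈)) (within-∷ t F v (C ─ v))

  within-free : ∀ t F → Unique C → v ∉ C →
                within t F (v ∷ C) + 1 ≡ within (suc t) (v ∷ F) C + 1 + within t F [ v ]
  within-free {C} {v} t F u v∉ = begin
    within t F (v ∷ C) + 1               ≡⟨ cong (_+ 1) (within-∷ t F v C) ⟩
    e + within t F C + 1                 ≡⟨ cong (λ k → e + k + 1) (within-shift t F u v∉) ⟨
    e + within (suc t) (v ∷ F) C + 1     ≡⟨ solve 2 (λ e m → e :+ m :+ con 1 := m :+ con 1 :+ e) refl e (within (suc t) (v ∷ F) C) ⟩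
    within (suc t) (v ∷ F) C + 1 + e     ∎
    where
    open ≡-Reasoning
    open +-*-Solver
    e : ℕ
    e = within t F [ v ]

  -- An eviction can only remove nodes from the count of `within-free`.
  step-within-≤ : ∀ t F → Step s v V C C′ n → Unique C →
                  within t F C′ + 1 ≤ within (suc t) (v ∷ F) C + n + within t F [ v ]
  step-within-≤ {v = v} {C = C} t F (hit v∈) u =
    ≤-reflexive (trans (within-hit t F u v∈) (cong (_+ within t F [ v ]) (sym (+-identityʳ (within (suc t) (v ∷ F) C)))))
  step-within-≤ t F (free v∉ _) u = ≤-reflexive (within-free t F u v∉)
  step-within-≤ {v = v} {C = C} t F (evict z v∉ _ _) u = ≤-trans (+-monoˡ-≤ 1 shrink) (≤-reflexive (within-free t F u v∉))
    where
    shrink : within t F (v ∷ (C ─ z)) ≤ within t F (v ∷ C)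
    shrink = count-≤ (λ x → delay x F ≤? t) (λ x → delay x F ≤? t)
      -- A fictitious step: with `s = 0` and a trivial `V` the eviction is always allowed, and it
      -- yields that the new content has no repetitions.
      (step-unique {s = 0} {V = λ _ → C ≡ C} (evict z v∉ z≤n refl) u)
      (λ { (here eq) le → here eq , le ; (there x∈) le → there (─-⊆ x∈) , le })

  -- The balance fails only if the victim itself is counted. The second alternative keeps what the
  -- size argument then needs: the cache is full and its victim is needed by time `t`.
  step-within-≥ : ∀ t F → Step s v V C C′ n → Unique C → (∀ {z} → V z → z ∈ C) →
                  within (suc t) (v ∷ F) C + n + within t F [ v ] ≤ within t F C′ + 1 ⊎
                  v ∉ C × s ≤ length C′ × ∃ λ z → V z × delay z F ≤ t
  step-within-≥ {v = v} {C = C} t F (hit v∈) u _ =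
    inj₁ (≤-reflexive (trans (cong (_+ within t F [ v ]) (+-identityʳ (within (suc t) (v ∷ F) C))) (sym (within-hit t F u v∈))))
  step-within-≥ t F (free v∉ _) u _ = inj₁ (≤-reflexive (sym (within-free t F u v∉)))
  step-within-≥ {s = s} {v = v} {C = C} t F (evict z v∉ full vz) u V⊆ with delay z F ≤? t
  ... | yes soon = inj₂ (v∉ , ≤-trans full (≤-reflexive (─-length u (V⊆ vz))) , z , vz , soon)
  ... | no late = inj₁ (≤-trans (≤-reflexive (sym (within-free t F u v∉))) (+-monoˡ-≤ 1 keep))
    where
    keep : within t F (v ∷ C) ≤ within t F (v ∷ (C ─ z))
    keep = count-≤ (λ x → delay x F ≤? t) (λ x → delay x F ≤? t)
      (step-unique {s = suc (length C)} {V = λ _ → C ≡ C} (free v∉ ≤-refl) u)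
      (λ { (here eq) le → here eq , le
         ; (there x∈) le → there (∈-─⁺ x∈ λ { refl → late le }) , le })

  Dominates : ℕ → List A → List A → List A → Set
  Dominates k F C M = ∀ t → within t F C ≤ within t F M + k

  -- `k` is the number of insertions that `M` may still make in excess of `C`: an insertion into `M`
  -- spends one unit, an insertion into `C` earns one. Nodes in `pinned` are exempt from the rule
  -- for `M` because `C` keeps them.
  exchange : ∀ {k s v F pinned C C′ nC M M′ nM} →
    Step s v (λ z → z ∈ M × (∀ {u} → u ∈ M → u ∈ pinned ⊎ delay u (v ∷ F) ≤ delay z (v ∷ F))) M M′ nM →
    Step s v (λ z → z ∈ C × z ∉ pinned) C C′ nC →
    Unique M → Unique C → length C ≤ s → pinned ⊆ C → Dominates k (v ∷ F) C M →
    ∃ λ k′ → nM + k′ ≡ k + nC × Dominates k′ F C′ M′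
  exchange {k} {s} {v} {F} {pinned} {C} {C′} {nC} {M} {M′} {nM} stM stC uM uC C≤s pinned⊆C dom =
    -- The subtraction is exact: only a miss of `M` at a hit of `C` could make it negative, and then
    -- `positive` provides a unit.
    k + nC ∸ nM , m+[n∸m]≡n (nM≤ stM stC) , dom′
    where
    positive : v ∉ M → v ∈ C → 1 ≤ k
    positive v∉M v∈C = begin
      1                        ≤⟨ ∈-length (∈-filter⁺ (λ x → delay x (v ∷ F) ≤? 0) v∈C (≤-reflexive (delay-here v F))) ⟩
      within 0 (v ∷ F) C       ≤⟨ dom 0 ⟩
      -- At time 0 only `v` counts, which `M` lacks. Comparison with the empty list bounds the count
      -- by 0.
      within 0 (v ∷ F) M + k   ≤⟨ +-monoˡ-≤ k (count-≤ (λ x → delay x (v ∷ F) ≤? 0) (λ x → delay x (v ∷ F) ≤? 0) {ys = []} uM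
                                    λ x∈ le → contradiction (subst (_≤ 0) (delay-there {xs = F} λ { refl → v∉M x∈ }) le) λ ()) ⟩
      k                        ∎
      where open ≤-Reasoning
    nM≤ : ∀ {M′ C′ nM nC VM VC} → Step s v VM M M′ nM → Step s v VC C C′ nC → nM ≤ k + nC
    nM≤ (hit _) _ = z≤n
    nM≤ (free _ _) (free _ _) = m≤n+m 1 k
    nM≤ (free _ _) (evict _ _ _ _) = m≤n+m 1 k
    nM≤ (evict _ _ _ _) (free _ _) = m≤n+m 1 k
    nM≤ (evict _ _ _ _) (evict _ _ _ _) = m≤n+m 1 k
    nM≤ (free v∉M _) (hit v∈C) = ≤-trans (positive v∉M v∈C) (m≤m+n k 0)
    nM≤ (evict _ v∉M _ _) (hit v∈C) = ≤-trans (positive v∉M v∈C) (m≤m+n k 0)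

    -- Past the victim's next access M′ holds nothing but what C′ holds as well,
    -- so there the bound follows from the sizes of the caches.
    late : v ∉ M → s ≤ length M′ → ∀ t z → (∀ {u} → u ∈ M → u ∈ pinned ⊎ delay u (v ∷ F) ≤ delay z (v ∷ F)) →
           z ∈ M → delay z F ≤ t → within t F C′ ≤ within t F M′
    late v∉M full t z far z∈M z≤t = +-cancelʳ-≤ (length (filter (¬? ∘ P?) M′)) _ _ (begin
      within t F C′ + length (filter (¬? ∘ P?) M′) ≤⟨ +-monoʳ-≤ (within t F C′) (count-≤ (¬? ∘ P?) (¬? ∘ P?) (step-unique stM uM) shared) ⟩
      within t F C′ + length (filter (¬? ∘ P?) C′) ≡⟨ filter-complement P? C′ ⟩
      length C′                                    ≤⟨ step-length stC proj₁ uC C≤s ⟩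
      s                                            ≤⟨ full ⟩
      length M′                                    ≡⟨ filter-complement P? M′ ⟨
      within t F M′ + length (filter (¬? ∘ P?) M′) ∎)
      where
      open ≤-Reasoning
      P? : Decidable λ x → delay x F ≤ t
      P? x = delay x F ≤? t
      shared : ∀ {x} → x ∈ M′ → ¬ delay x F ≤ t → x ∈ C′ × ¬ delay x F ≤ t
      shared x∈ x≰t with step-⊆ stM x∈
      ... | here refl = v∈step stC , x≰t
      ... | there x∈M with far x∈M
      ...   | inj₁ x∈pinned = step-survives stC (pinned⊆C x∈pinned) (λ _ _ (_ , x∉pinned) → x∉pinned x∈pinned) , x≰t
      ...   | inj₂ x≤z = contradiction
              (≤-trans (s≤s⁻¹ (subst₂ _≤_ (delay-there λ { refl → v∉M x∈M }) (delay-there λ { refl → v∉M z∈M }) x≤z)) z≤t)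
              x≰t

    balance : ∀ t → within (suc t) (v ∷ F) M + nM + within t F [ v ] ≤ within t F M′ + 1 →
              within t F C′ ≤ within t F M′ + (k + nC ∸ nM)
    balance t le = +-cancelʳ-≤ (nM + 1) _ _ (begin
      pC + (nM + 1)               ≡⟨ solve 2 (λ p n → p :+ (n :+ con 1) := p :+ con 1 :+ n) refl pC nM ⟩
      pC + 1 + nM                 ≤⟨ +-monoˡ-≤ nM (step-within-≤ t F stC uC) ⟩
      mC + nC + e + nM            ≤⟨ +-monoˡ-≤ nM (+-monoˡ-≤ e (+-monoˡ-≤ nC (dom (suc t)))) ⟩
      mM + k + nC + e + nM        ≡⟨ solve 5 (λ m k c e n → m :+ k :+ c :+ e :+ n := m :+ n :+ e :+ (k :+ c)) refl mM k nC e nM ⟩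
      mM + nM + e + (k + nC)      ≤⟨ +-monoˡ-≤ (k + nC) le ⟩
      pM + 1 + (k + nC)           ≡⟨ cong (pM + 1 +_) (m+[n∸m]≡n (nM≤ stM stC)) ⟨
      pM + 1 + (nM + k′)          ≡⟨ solve 3 (λ p n k → p :+ con 1 :+ (n :+ k) := p :+ k :+ (n :+ con 1)) refl pM nM k′ ⟩
      pM + k′ + (nM + 1)          ∎)
      where
      open ≤-Reasoning
      open +-*-Solver
      pC pM mC mM e k′ : ℕ
      pC = within t F C′
      pM = within t F M′
      mC = within (suc t) (v ∷ F) C
      mM = within (suc t) (v ∷ F) M
      e  = within t F [ v ]
      k′ = k + nC ∸ nM

    dom′ : Dominates (k + nC ∸ nM) F C′ M′
    dom′ t with step-within-≥ t F stM uM proj₁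
    ... | inj₁ le = balance t le
    ... | inj₂ (v∉M , full , z , (z∈M , far) , soon) = ≤-trans (late v∉M full t z far z∈M soon) (m≤m+n _ _)

  -- Recency orders

  Furthest : List A → List A → A → Set
  Furthest h C z = z ∈ C × (∀ {u} → u ∈ C → delay u h ≤ delay z h)

  -- The content consists of the most recent nodes of `h`, which need not be the true history: for
  -- ISLRU it is a rearranged one.
  Recency : List A → List A → Set
  Recency h C = ∀ {x y} → x ∈ C → y ∉ C → delay x h ≤ delay y h

  delay-∷-mono : ∀ v → y ≢ v → delay x h ≤ delay y h → delay x (v ∷ h) ≤ delay y (v ∷ h)
  delay-∷-mono {x = x} {h} v y≢v le with x ≟ v
  ... | yes refl = z≤n
  ... | no _ = subst (_ ≤_) (sym (delay-there {xs = h} y≢v)) (s≤s le)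

  -- An eviction adds the victim to the uncached nodes, and its choice as oldest is what this new
  -- comparison requires.
  recency-step : Step s v (Furthest h C) C C′ n → Recency h C → Recency (v ∷ h) C′
  recency-step {v = v} {h = h} (hit v∈C) rec {x} x∈ y∉ =
    delay-∷-mono {x = x} {h} v (λ { refl → y∉ v∈C }) (rec x∈ y∉)
  recency-step {v = v} {h = h} (free _ _) rec {x} {y} (here refl) y∉ = ≤-trans (≤-reflexive (delay-here v h)) z≤n
  recency-step {v = v} {h = h} (free _ _) rec {x} {y} (there x∈) y∉ =
    delay-∷-mono {x = x} {h} v (y∉ ∘ here) (rec x∈ (y∉ ∘ there))
  recency-step {v = v} {h = h} (evict _ _ _ _) rec {x} {y} (here refl) y∉ = ≤-trans (≤-reflexive (delay-here v h)) z≤n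
  recency-step {v = v} {h = h} (evict z _ _ (z∈ , far)) rec {x} {y} (there x∈) y∉ =
    delay-∷-mono {x = x} {h} v (y∉ ∘ here) x≤y
    where
    x≤y : delay x h ≤ delay y h
    x≤y with y ≟ z
    ... | yes refl = far (─-⊆ x∈)
    ... | no y≢z   = rec (─-⊆ x∈) λ y∈ → y∉ (there (∈-─⁺ y∈ λ { refl → y≢z refl }))

  -- Before its first eviction a cache holds its whole history; from then on it is full.
  Saturated : ℕ → List A → List A → Set
  Saturated s h C = s ≤ length C ⊎ h ⊆ C

  saturated-step : Step s v V C C′ n → (∀ {z} → V z → z ∈ C) → Unique C → Saturated s h C → Saturated s (v ∷ h) C′
  saturated-step (hit _) _ _ (inj₁ full) = inj₁ full
  saturated-step (hit v∈C) _ _ (inj₂ h⊆) = inj₂ λ { (here refl) → v∈C ; (there x∈) → h⊆ x∈ }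
  saturated-step (free _ lt) _ _ (inj₁ full) = contradiction full (<⇒≱ lt)
  saturated-step (free _ _) _ _ (inj₂ h⊆) = inj₂ λ { (here refl) → here refl ; (there x∈) → there (h⊆ x∈) }
  saturated-step (evict _ _ full vz) V⊆ u _ = inj₁ (≤-trans full (≤-reflexive (─-length u (V⊆ vz))))

  -- Missing nodes of a path

  misses : List A → List A → ℕ
  misses C = length ∘ filter (¬? ∘ (_∈? C))

  misses-hit : ∀ C xs → v ∈ C → misses C (v ∷ xs) ≡ misses C xs
  misses-hit C xs v∈ = cong length (filter-reject (¬? ∘ (_∈? C)) {xs = xs} λ v∉ → v∉ v∈)

  misses-miss : ∀ C xs → v ∉ C → misses C (v ∷ xs) ≡ suc (misses C xs)
  misses-miss C xs v∉ = cong length (filter-accept (¬? ∘ (_∈? C)) {xs = xs} v∉)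

  misses-antitone : ∀ C D → Unique xs → (∀ {x} → x ∈ xs → x ∈ C → x ∈ D) → misses D xs ≤ misses C xs
  misses-antitone C D u keep =
    count-≤ (¬? ∘ (_∈? D)) (¬? ∘ (_∈? C)) u λ x∈ x∉D → x∈ , x∉D ∘ keep x∈

  -- Inserting `v` settles one miss, and a victim outside `xs` creates none.
  misses-step-≤ : ∀ {s v V C C′ n xs} → Step s v V C C′ n → Unique xs → (∀ {z} → v ∉ C → V z → z ∉ xs) →
                  n + misses C′ xs ≤ misses C (v ∷ xs)
  misses-step-≤ {C = C} {xs = xs} (hit v∈) _ _ = ≤-reflexive (sym (misses-hit C xs v∈))
  misses-step-≤ {v = v} {C = C} {xs = xs} (free v∉ _) u away =
    ≤-trans (s≤s (misses-antitone C (v ∷ C) u λ _ x∈C → there x∈C))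
            (≤-reflexive (sym (misses-miss C xs v∉)))
  misses-step-≤ {v = v} {C = C} {xs = xs} (evict z v∉ _ vz) u away =
    ≤-trans (s≤s (misses-antitone C (v ∷ (C ─ z)) u λ x∈ x∈C → there (∈-─⁺ x∈C λ { refl → away v∉ vz x∈ })))
            (≤-reflexive (sym (misses-miss C xs v∉)))

  -- Evictions can only add misses, and by `v ∉ xs` the insertion of `v` removes none from `xs`.
  misses-step-≥ : ∀ {s v V C C′ n xs} → Step s v V C C′ n → Unique xs → v ∉ xs →
                  misses C (v ∷ xs) ≤ n + misses C′ xs
  misses-step-≥ {C = C} {xs = xs} (hit v∈) _ _ = ≤-reflexive (misses-hit C xs v∈)
  misses-step-≥ {v = v} {C = C} {xs = xs} (free v∉ _) u v∉xs =
    ≤-trans (≤-reflexive (misses-miss C xs v∉))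
      (s≤s (misses-antitone (v ∷ C) C u λ { x∈ (here refl) → contradiction x∈ v∉xs ; _ (there x∈C) → x∈C }))
  misses-step-≥ {v = v} {C = C} {xs = xs} (evict z v∉ _ _) u v∉xs =
    ≤-trans (≤-reflexive (misses-miss C xs v∉))
      (s≤s (misses-antitone (v ∷ (C ─ z)) C u λ { x∈ (here refl) → contradiction x∈ v∉xs ; _ (there x∈C) → ─-⊆ x∈C }))

  -- |C| + misses C xs is the size of the union of C and xs.
  misses-union : ∀ {C D} → Unique C → Unique xs → length D ≤ length C → (∀ {x} → x ∈ C → x ∈ D ⊎ x ∈ xs) →
                 misses C xs ≤ misses D xs
  misses-union {xs} {C} {D} uC uxs D≤C C⊆ = +-cancelˡ-≤ (length C) _ _ (begin
    length C + misses C xs                     ≡⟨ length-++ C ⟨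
    length (C ++ filter (¬? ∘ (_∈? C)) xs)     ≤⟨ unique-⊆⇒length-≤ (Unique.++⁺ uC (Unique.filter⁺ (¬? ∘ (_∈? C)) uxs) disjoint) sub ⟩
    length (D ++ filter (¬? ∘ (_∈? D)) xs)     ≡⟨ length-++ D ⟩
    length D + misses D xs                     ≤⟨ +-monoˡ-≤ _ D≤C ⟩
    length C + misses D xs                     ∎)
    where
    open ≤-Reasoning
    disjoint : ∀ {x} → ¬ (x ∈ C × x ∈ filter (¬? ∘ (_∈? C)) xs)
    disjoint (x∈C , x∈) = proj₂ (∈-filter⁻ (¬? ∘ (_∈? C)) {xs = xs} x∈) x∈C
    place : ∀ {x} → x ∈ D ⊎ x ∈ xs → x ∈ D ++ filter (¬? ∘ (_∈? D)) xs
    place (inj₁ x∈D) = ∈-++⁺ˡ x∈D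
    place {x} (inj₂ x∈xs) with x ∈? D
    ... | yes x∈D = ∈-++⁺ˡ x∈D
    ... | no x∉D  = ∈-++⁺ʳ D (∈-filter⁺ (¬? ∘ (_∈? D)) x∈xs x∉D)
    sub : C ++ filter (¬? ∘ (_∈? C)) xs ⊆ D ++ filter (¬? ∘ (_∈? D)) xs
    sub x∈ with ∈-++⁻ C x∈
    ... | inj₁ x∈C = place (C⊆ x∈C)
    ... | inj₂ x∈f = place (inj₂ (proj₁ (∈-filter⁻ (¬? ∘ (_∈? C)) {xs = xs} x∈f)))

  -- Either `D` holds no node of `xs` that `C` lacks, and inclusion decides, or such a node exists,
  -- and `why` supplies the premises of `misses-union`.
  misses-compare : ∀ {C D} → Unique C → Unique xs →
    (∀ {y} → y ∈ xs → y ∈ D → y ∉ C → length D ≤ length C × (∀ {x} → x ∈ C → x ∈ D ⊎ x ∈ xs)) →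
    misses C xs ≤ misses D xs
  misses-compare {xs} {C} {D} uC uxs why with any? (λ y → (y ∈? D) ×-dec ¬? (y ∈? C)) xs
  ... | yes some with find some
  ...   | y , y∈xs , y∈D , y∉C = let D≤C , C⊆ = why y∈xs y∈D y∉C in misses-union uC uxs D≤C C⊆
  misses-compare {xs} {C} {D} uC uxs why | no none = misses-antitone D C uxs keep
    where
    keep : ∀ {x} → x ∈ xs → x ∈ D → x ∈ C
    keep {x} x∈xs x∈D with x ∈? C
    ... | yes x∈C = x∈C
    ... | no x∉C  = contradiction (lose x∈xs (x∈D , x∉C)) none

  -- Competitiveness of LRU

  -- recent is the set of distinct nodes requested in the current phase, older
  -- holds the nodes the adversary's cache C may still profit from, and credit
  -- is at most twice the insertions into C minus those into L so far.
  record Phase (h : ℕ) (past L C : List A) (credit : ℕ) : Set where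
    field
      recent older : List A
      uniqueL      : Unique L
      uniqueC      : Unique C
      C≤h          : length C ≤ h
      unique       : Unique recent
      recent≤2h    : length recent ≤ 2 * h
      recent⊆L     : recent ⊆ L
      latest       : ∀ {x y} → x ∈ recent → y ∉ recent → delay x past < delay y past
      covered      : C ⊆ older ++ recent
      -- Each older node may cost `L` an insertion at a hit of `C`.
      older≤       : length older ≤ credit
      -- Once `recent` has `2 * h` nodes, this gives `h ≤ credit`. That pays for the first node of
      -- the next phase and for its older nodes, at most `h ∸ 1` of them.
      bound        : length recent + 2 * length older ≤ credit + h

  module _ {h past v L L′ C C′ nL nC credit} (h≥1 : 1 ≤ h)
           (stL : Step (2 * h) v (Furthest past L) L L′ nL) (stC : Step h v (_∈ C) C C′ nC)
           (ph : Phase h past L C credit) where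
    open Phase ph

    private
      C′≤h : length C′ ≤ h
      C′≤h = step-length stC id uniqueC C≤h

      step-≤1 : ∀ {s V C C′ n} → Step s v V C C′ n → n ≤ 1
      step-≤1 (hit _)         = z≤n
      step-≤1 (free _ _)      = ≤-refl
      step-≤1 (evict _ _ _ _) = ≤-refl

      step-hit : ∀ {s V C C′ n} → Step s v V C C′ n → v ∈ C → n ≡ 0
      step-hit (hit _) _ = refl
      step-hit (free v∉ _) v∈ = contradiction v∈ v∉
      step-hit (evict _ v∉ _ _) v∈ = contradiction v∈ v∉

      step-miss : ∀ {s V C C′ n} → Step s v V C C′ n → v ∉ C → n ≡ 1
      step-miss (hit v∈) v∉ = contradiction v∈ v∉
      step-miss (free _ _) _ = refl
      step-miss (evict _ _ _ _) _ = refl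

      known : v ∈ recent → ∃ λ credit′ → Phase h (v ∷ past) L′ C′ credit′ × nL + credit′ ≤ 2 * nC + credit
      known v∈U = credit , record
        { recent = recent ; older = older
        ; uniqueL = step-unique stL uniqueL ; uniqueC = step-unique stC uniqueC ; C≤h = C′≤h
        ; unique = unique ; recent≤2h = recent≤2h
        ; recent⊆L = λ x∈ → step-survives stL (recent⊆L x∈) λ v∉L → contradiction (recent⊆L v∈U) v∉L
        ; latest = latest′ ; covered = covered′ ; older≤ = older≤ ; bound = bound }
        , subst (λ n → n + credit ≤ 2 * nC + credit) (sym (step-hit stL (recent⊆L v∈U))) (m≤n+m credit (2 * nC))
        where
        latest′ : ∀ {x y} → x ∈ recent → y ∉ recent → delay x (v ∷ past) < delay y (v ∷ past)
        latest′ {x} {y} x∈ y∉ with x ≟ v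
        ... | yes refl = subst (0 <_) (sym (delay-there {xs = past} λ { refl → y∉ v∈U })) (s≤s z≤n)
        ... | no _ = subst (_ <_) (sym (delay-there {xs = past} λ { refl → y∉ v∈U })) (s≤s (latest x∈ y∉))
        covered′ : C′ ⊆ older ++ recent
        covered′ x∈ with step-⊆ stC x∈
        ... | here refl = ∈-++⁺ʳ older v∈U
        ... | there x∈C = covered x∈C

      module New (v∉U : v ∉ recent) where
        latest′ : ∀ {x y} → x ∈ v ∷ recent → y ∉ v ∷ recent → delay x (v ∷ past) < delay y (v ∷ past)
        latest′ (here refl) y∉ =
          subst₂ _<_ (sym (delay-here v past)) (sym (delay-there {xs = past} (y∉ ∘ here))) (s≤s z≤n)
        latest′ (there x∈) y∉ =
          subst₂ _<_ (sym (delay-there {xs = past} λ { refl → v∉U x∈ })) (sym (delay-there {xs = past} (y∉ ∘ here)))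
            (s≤s (latest x∈ (y∉ ∘ there)))

        unique′ : Unique (v ∷ recent)
        unique′ = All.tabulate (λ { x∈ refl → v∉U x∈ }) ∷ unique

        module Same (U<2h : length recent < 2 * h) where
          -- `L` is full and `recent` is smaller, so some cached node lies outside `recent` and is
          -- older than all of it.
          safe : ∀ {x} → x ∈ recent → 2 * h ≤ length L → ¬ Furthest past L x
          safe x∈ full (_ , far) =
            let y , y∈L , y∉U = pigeonhole _≟_ uniqueL (<-≤-trans U<2h full)
            in <⇒≱ (latest x∈ y∉U) (far y∈L)

          recent⊆L′ : v ∷ recent ⊆ L′
          recent⊆L′ (here refl) = v∈step stL
          recent⊆L′ (there x∈)  = step-survives stL (recent⊆L x∈) λ _ → safe x∈

          -- `C` may have a hit, so the credit pays for `L`. The left side of `bound` drops by at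
          -- least one, the right side by exactly one.
          old : v ∈ older → ∃ λ credit′ → Phase h (v ∷ past) L′ C′ credit′ × nL + credit′ ≤ 2 * nC + credit
          old v∈D = credit ∸ 1 , record
            { recent = v ∷ recent ; older = older ─ v
            ; uniqueL = step-unique stL uniqueL ; uniqueC = step-unique stC uniqueC ; C≤h = C′≤h
            ; unique = unique′ ; recent≤2h = U<2h
            ; recent⊆L = recent⊆L′ ; latest = latest′ ; covered = covered′
            ; older≤ = s≤s⁻¹ (≤-trans shorter (≤-trans older≤ (≤-reflexive (sym pred+1)))) ; bound = bound′ }
            , (begin
                nL + (credit ∸ 1)      ≤⟨ +-monoˡ-≤ (credit ∸ 1) (step-≤1 stL) ⟩
                suc (credit ∸ 1)       ≡⟨ pred+1 ⟩
                credit                 ≤⟨ m≤n+m credit (2 * nC) ⟩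
                2 * nC + credit        ∎)
            where
            open ≤-Reasoning
            shorter : suc (length (older ─ v)) ≤ length older
            shorter = ─-shorter v∈D
            pred+1 : suc (credit ∸ 1) ≡ credit
            pred+1 = m+[n∸m]≡n (≤-trans (≤-trans (s≤s z≤n) shorter) older≤)
            covered′ : C′ ⊆ (older ─ v) ++ v ∷ recent
            covered′ {x} x∈ with x ≟ v | step-⊆ stC x∈
            ... | yes refl | _ = ∈-++⁺ʳ (older ─ v) (here refl)
            ... | no x≢v | here x≡v = contradiction x≡v x≢v
            ... | no x≢v | there x∈C with ∈-++⁻ older (covered x∈C)
            ...   | inj₁ x∈D = ∈-++⁺ˡ (∈-─⁺ x∈D λ { refl → x≢v refl })
            ...   | inj₂ x∈U = ∈-++⁺ʳ (older ─ v) (there x∈U)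
            bound′ : suc (length recent) + 2 * length (older ─ v) ≤ credit ∸ 1 + h
            bound′ = s≤s⁻¹ (begin
              2 + length recent + 2 * length (older ─ v)   ≡⟨ solve 2 (λ u o → con 2 :+ u :+ con 2 :* o := u :+ con 2 :* (con 1 :+ o)) refl
                                                                (length recent) (length (older ─ v)) ⟩
              length recent + 2 * suc (length (older ─ v)) ≤⟨ +-monoʳ-≤ (length recent) (*-monoʳ-≤ 2 shorter) ⟩
              length recent + 2 * length older             ≤⟨ bound ⟩
              credit + h                                   ≡⟨ cong (_+ h) pred+1 ⟨
              suc (credit ∸ 1) + h                         ∎)
              where open +-*-Solver

          -- By `covered`, `C` has a miss. Of the two units this brings, one pays for `L` and one is
          -- saved.
          fresh : v ∉ older → ∃ λ credit′ → Phase h (v ∷ past) L′ C′ credit′ × nL + credit′ ≤ 2 * nC + credit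
          fresh v∉D = suc credit , record
            { recent = v ∷ recent ; older = older
            ; uniqueL = step-unique stL uniqueL ; uniqueC = step-unique stC uniqueC ; C≤h = C′≤h
            ; unique = unique′ ; recent≤2h = U<2h
            ; recent⊆L = recent⊆L′ ; latest = latest′ ; covered = covered′
            ; older≤ = m≤n⇒m≤1+n older≤ ; bound = s≤s bound }
            , subst (λ n → nL + suc credit ≤ 2 * n + credit) (sym (step-miss stC v∉C))
                (+-monoˡ-≤ (suc credit) (step-≤1 stL))
            where
            v∉C : v ∉ C
            v∉C v∈C with ∈-++⁻ older (covered v∈C)
            ... | inj₁ v∈D = v∉D v∈D
            ... | inj₂ v∈U = v∉U v∈U
            covered′ : C′ ⊆ older ++ v ∷ recent
            covered′ x∈ with step-⊆ stC x∈
            ... | here refl = ∈-++⁺ʳ older (here refl)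
            ... | there x∈C with ∈-++⁻ older (covered x∈C)
            ...   | inj₁ x∈D = ∈-++⁺ˡ x∈D
            ...   | inj₂ x∈U = ∈-++⁺ʳ older (there x∈U)

        -- `v` opens a new phase and is paid from the credit. What `C` now holds besides `v`, fewer
        -- than `h` nodes, becomes `older`.
        restart : 2 * h ≤ length recent → ∃ λ credit′ → Phase h (v ∷ past) L′ C′ credit′ × nL + credit′ ≤ 2 * nC + credit
        restart 2h≤U = credit ∸ 1 , record
          { recent = [ v ] ; older = C′ ─ v
          ; uniqueL = step-unique stL uniqueL ; uniqueC = step-unique stC uniqueC ; C≤h = C′≤h
          ; unique = [] ∷ [] ; recent≤2h = ≤-trans h≥1 (m≤m+n h (h + 0))
          ; recent⊆L = λ { (here refl) → v∈step stL } ; latest = latest″ ; covered = covered′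
          ; older≤ = older≤′ ; bound = bound′ }
          , (begin
              nL + (credit ∸ 1)      ≤⟨ +-monoˡ-≤ (credit ∸ 1) (step-≤1 stL) ⟩
              suc (credit ∸ 1)       ≡⟨ pred+1 ⟩
              credit                 ≤⟨ m≤n+m credit (2 * nC) ⟩
              2 * nC + credit        ∎)
          where
          open ≤-Reasoning
          h≤credit : h ≤ credit
          h≤credit = +-cancelʳ-≤ h h credit (begin
            h + h                             ≡⟨ cong (h +_) (+-identityʳ h) ⟨
            2 * h                             ≤⟨ 2h≤U ⟩
            length recent                     ≤⟨ m≤m+n _ _ ⟩
            length recent + 2 * length older  ≤⟨ bound ⟩
            credit + h                        ∎)
          pred+1 : suc (credit ∸ 1) ≡ credit
          pred+1 = m+[n∸m]≡n (≤-trans h≥1 h≤credit)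
          shorter : suc (length (C′ ─ v)) ≤ h
          shorter = ≤-trans (─-shorter (v∈step stC)) C′≤h
          older≤′ : length (C′ ─ v) ≤ credit ∸ 1
          older≤′ = s≤s⁻¹ (≤-trans shorter (≤-trans h≤credit (≤-reflexive (sym pred+1))))
          latest″ : ∀ {x y} → x ∈ [ v ] → y ∉ [ v ] → delay x (v ∷ past) < delay y (v ∷ past)
          latest″ (here refl) y∉ =
            subst₂ _<_ (sym (delay-here v past)) (sym (delay-there {xs = past} (y∉ ∘ here))) (s≤s z≤n)
          covered′ : C′ ⊆ (C′ ─ v) ++ [ v ]
          covered′ {x} x∈ with x ≟ v
          ... | yes refl = ∈-++⁺ʳ (C′ ─ v) (here refl)
          ... | no x≢v   = ∈-++⁺ˡ (∈-─⁺ x∈ λ { refl → x≢v refl })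
          bound′ : 1 + 2 * length (C′ ─ v) ≤ credit ∸ 1 + h
          bound′ = begin
            1 + 2 * o        ≡⟨ solve 1 (λ o → con 1 :+ con 2 :* o := o :+ (con 1 :+ o)) refl o ⟩
            o + suc o        ≤⟨ +-mono-≤ older≤′ shorter ⟩
            credit ∸ 1 + h   ∎
            where
            open +-*-Solver
            o : ℕ
            o = length (C′ ─ v)

    phase-step : ∃ λ credit′ → Phase h (v ∷ past) L′ C′ credit′ × nL + credit′ ≤ 2 * nC + credit
    phase-step with v ∈? recent
    ... | yes v∈U = known v∈U
    ... | no v∉U with length recent <? 2 * h | v ∈? older
    ...   | no ≮ | _ = New.restart v∉U (≮⇒≥ ≮)
    ...   | yes lt | yes v∈D = New.Same.old v∉U lt v∈D
    ...   | yes lt | no v∉D  = New.Same.fresh v∉U lt v∉D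

-- The properties of translation paths on which the comparisons rest

record PathSystem : Set₁ where
  field
    Node Address : Set
    _≟_          : DecidableEquality Node
    path         : Address → List Node
    height       : ℕ
    layer        : Node → ℕ
    -- w ⊑ x : w is a descendant of x or x itself.
    _⊑_          : Node → Node → Set

  open Paging _≟_ using (delay)

  field
    path-unique     : ∀ α → Unique (path α)
    path-length     : ∀ α → length (path α) ≡ suc height
    delay-path      : ∀ {x α} → x ∈ path α → delay x (path α) + layer x ≡ height
    layer-mono      : ∀ {w x} → w ⊑ x → layer w ≤ layer x
    ancestor-∈-path : ∀ {w x α} → w ⊑ x → w ∈ path α → x ∈ path α
    path-chain      : ∀ {w x α} → w ∈ path α → x ∈ path α → layer w ≤ layer x → w ⊑ x

-- Caches followed translation by translation

module Rounds (S : PathSystem) where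

  open PathSystem S
  open Paging _≟_
  open import Data.List.Membership.DecPropositional _≟_ using (_∈?_)

  private variable
    u v w x y z : Node
    xs : List Node

  path-order : ∀ {α} → x ∈ path α → y ∈ path α → layer y ≤ layer x → delay x (path α) ≤ delay y (path α)
  path-order {x = x} {y = y} {α = α} x∈ y∈ y≤x = +-cancelʳ-≤ (layer x) _ _ (begin
    delay x (path α) + layer x  ≡⟨ trans (delay-path x∈) (sym (delay-path y∈)) ⟩
    delay y (path α) + layer y  ≤⟨ +-monoʳ-≤ (delay y (path α)) y≤x ⟩
    delay y (path α) + layer x  ∎)
    where open ≤-Reasoning

  path-order⁻ : ∀ {α} → x ∈ path α → y ∈ path α → delay x (path α) ≤ delay y (path α) → layer y ≤ layer x
  path-order⁻ {x = x} {y = y} {α = α} x∈ y∈ x≤y = +-cancelˡ-≤ (delay y (path α)) _ _ (begin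
    delay y (path α) + layer y  ≡⟨ trans (delay-path y∈) (sym (delay-path x∈)) ⟩
    delay x (path α) + layer x  ≤⟨ +-monoˡ-≤ (layer x) x≤y ⟩
    delay y (path α) + layer x  ∎)
    where open ≤-Reasoning

  flat : List Address → List Node
  flat = concatMap path

  -- Every path through `w` passes through its ancestor `x` first.
  delay-flat-mono : ∀ αs → w ⊑ x → delay x (flat αs) ≤ delay w (flat αs)
  delay-flat-mono [] _ = z≤n
  delay-flat-mono {w} {x} (α ∷ αs) desc = by-cases (w ∈? path α) (x ∈? path α)
    where
    by-cases : Dec (w ∈ path α) → Dec (x ∈ path α) → delay x (path α ++ flat αs) ≤ delay w (path α ++ flat αs)
    by-cases (yes w∈) (no x∉)  = contradiction (ancestor-∈-path desc w∈) x∉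
    by-cases (no w∉)  (yes x∈) = <⇒≤ (delay-++-< x∈ w∉)
    by-cases (no w∉)  (no x∉)  = delay-++-mono x∉ w∉ (delay-flat-mono αs desc)
    by-cases (yes w∈) (yes x∈) =
      subst₂ _≤_ (sym (delay-++-∈ x∈)) (sym (delay-++-∈ w∈)) (path-order x∈ w∈ (layer-mono desc))

  -- A translation in progress: done ʳ++ rem ≡ path α, where done lists the
  -- completed accesses, latest first.

  ʳ++-unique : ∀ (done : List Node) → Unique (done ʳ++ xs) → Unique xs × (∀ {x} → x ∈ done → x ∉ xs)
  ʳ++-unique [] u = u , λ ()
  ʳ++-unique (x ∷ done) u with ʳ++-unique done u
  ... | (x≢ ∷ u′) , away = u′ , λ { (here refl) x∈ → All.lookup x≢ x∈ refl ; (there y∈) y∈xs → away y∈ (there y∈xs) }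

  module _ {α : Address} {done rem : List Node} (split : done ʳ++ rem ≡ path α) where

    private
      split′ : reverse done ++ rem ≡ path α
      split′ = trans (sym (ʳ++-defn done)) split

      uniques : Unique rem × (∀ {x} → x ∈ done → x ∉ rem)
      uniques = ʳ++-unique done (subst Unique (sym split) (path-unique α))

    rem-unique : Unique rem
    rem-unique = proj₁ uniques

    done⇒∉rem : x ∈ done → x ∉ rem
    done⇒∉rem = proj₂ uniques

    done⊆path : done ⊆ path α
    done⊆path x∈ = subst (_ ∈_) split′ (∈-++⁺ˡ (∈-resp-↭ (↭-sym (↭-reverse done)) x∈))

    rem⊆path : rem ⊆ path α
    rem⊆path x∈ = subst (_ ∈_) split′ (∈-++⁺ʳ (reverse done) x∈)

    path⊆ : x ∈ path α → x ∈ done ⊎ x ∈ rem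
    path⊆ x∈ with ∈-++⁻ (reverse done) (subst (_ ∈_) (sym split′) x∈)
    ... | inj₁ x∈done = inj₁ (∈-resp-↭ (↭-reverse done) x∈done)
    ... | inj₂ x∈rem  = inj₂ x∈rem

    done+rem : length done + length rem ≡ suc height
    done+rem = trans (sym (length-ʳ++ done)) (trans (cong length split) (path-length α))

    done-above-rem : x ∈ done → y ∈ rem → layer y ≤ layer x
    done-above-rem {x} {y} x∈ y∈ = path-order⁻ (done⊆path x∈) (rem⊆path y∈)
      (<⇒≤ (subst (λ p → delay x p < delay y p) split′
        (delay-++-< (∈-resp-↭ (↭-sym (↭-reverse done)) x∈) λ y∈done → done⇒∉rem (∈-resp-↭ (↭-reverse done) y∈done) y∈)))

    -- An ancestor still to be accessed would lie no higher than `w`, hence on the same layer of the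
    -- same path, and would be `w` itself.
    done-closed : w ⊑ x → w ∈ done → x ∈ done
    done-closed {w} {x} desc w∈ with path⊆ (ancestor-∈-path desc (done⊆path w∈))
    ... | inj₁ x∈done = x∈done
    ... | inj₂ x∈rem  = subst (_∈ done) (same-layer (done⊆path w∈) (rem⊆path x∈rem)) w∈
      where
      same-layer : w ∈ path α → x ∈ path α → w ≡ x
      same-layer w∈p x∈p = delay-injective w∈p (+-cancelʳ-≡ (layer w) _ _
        (trans (delay-path w∈p) (trans (sym (delay-path x∈p))
          (cong (delay x (path α) +_) (sym (≤-antisym (layer-mono desc) (done-above-rem w∈ x∈rem)))))))

  -- The completed translations, latest first, and the accesses they caused.
  data History : List Address → List Node → Set where
    []  : History [] []
    _∷_ : ∀ {α αs block old} → reverse block ≡ path α → History αs old → History (α ∷ αs) (block ++ old)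

  module _ {α : Address} {block : List Node} (eq : reverse block ≡ path α) where

    block⊆path : block ⊆ path α
    block⊆path x∈ = subst (_ ∈_) eq (∈-resp-↭ (↭-sym (↭-reverse block)) x∈)

    path⊆block : path α ⊆ block
    path⊆block x∈ = ∈-resp-↭ (↭-reverse block) (subst (_ ∈_) (sym eq) x∈)

    -- A finished path is recorded leaf first, and the leaf has layer 0.
    delay-block : x ∈ block → delay x block ≡ layer x
    delay-block {x} x∈ = suc-injective (+-cancelˡ-≡ (delay x (path α)) _ _ (begin
      p + suc (delay x block)             ≡⟨ +-suc p _ ⟩
      suc (p + delay x block)             ≡⟨ cong suc (+-comm p _) ⟩
      suc (delay x block + p)             ≡⟨ +-suc _ p ⟨
      delay x block + suc p               ≡⟨ cong (λ xs → delay x xs + suc p)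
                                                  (trans (sym (reverse-involutive block)) (cong reverse eq)) ⟩
      delay x (reverse (path α)) + suc p  ≡⟨ delay-reverse (path-unique α) x∈p ⟩
      length (path α)                     ≡⟨ path-length α ⟩
      suc height                          ≡⟨ cong suc (delay-path x∈p) ⟨
      suc (p + layer x)                   ≡⟨ +-suc p (layer x) ⟨
      p + suc (layer x)                   ∎))
      where
      open ≡-Reasoning
      x∈p : x ∈ path α
      x∈p = block⊆path x∈
      p : ℕ
      p = delay x (path α)

  old⊆flat : ∀ {αs old} → History αs old → old ⊆ flat αs
  old⊆flat (_∷_ {α} {block = block} eq hist) x∈ with ∈-++⁻ block x∈
  ... | inj₁ x∈block = ∈-++⁺ˡ (block⊆path eq x∈block)
  ... | inj₂ x∈old   = ∈-++⁺ʳ (path α) (old⊆flat hist x∈old)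

  -- With the paths of the history listed root first, descendants count as
  -- older than their ancestors, and a victim of ISLRU is simply the oldest node.
  islru-order : ∀ {αs old} → History αs old → w ⊑ x →
    delay w old ≤ delay x old → delay u old ≤ delay x old →
    (u ⊑ x → layer w ≤ layer u) →
    delay u (flat αs) ≤ delay w (flat αs)
  islru-order [] _ _ _ _ = z≤n
  islru-order {w} {x} {u} (_∷_ {α} {αs} {block} {old} eq hist) desc w≤x u≤x lowest = by-cases (x ∈? block) (u ∈? block)
    where
    in-block : ∀ {y} → x ∈ block → delay y (block ++ old) ≤ delay x (block ++ old) → y ∈ block
    in-block {y} x∈ y≤x with y ∈? block
    ... | yes y∈ = y∈
    ... | no y∉  = contradiction y≤x (<⇒≱ (delay-++-< x∈ y∉))
    by-cases : Dec (x ∈ block) → Dec (u ∈ block) → delay u (path α ++ flat αs) ≤ delay w (path α ++ flat αs)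
    -- The latest path contains `x` and with it the nodes `w` and `u`, which are no older. On this
    -- path `u` lies below `x`, so the choice of `w` as lowest descendant applies to `u`.
    by-cases (yes x∈) _ = subst₂ _≤_ (sym (delay-++-∈ u∈p)) (sym (delay-++-∈ w∈p))
      (path-order u∈p w∈p (lowest (path-chain u∈p (block⊆path eq x∈) u-below-x)))
      where
      u∈p : u ∈ path α
      u∈p = block⊆path eq (in-block x∈ u≤x)
      w∈p : w ∈ path α
      w∈p = block⊆path eq (in-block x∈ w≤x)
      block-delay : ∀ {y} → y ∈ block → delay y (block ++ old) ≡ layer y
      block-delay y∈ = trans (delay-++-∈ y∈) (delay-block eq y∈)
      u-below-x : layer u ≤ layer x
      u-below-x = subst₂ _≤_ (block-delay (in-block x∈ u≤x)) (block-delay x∈) u≤x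
    by-cases (no x∉) u∈? = beyond u∈?
      where
      -- A path through `w` would contain its ancestor `x`.
      w∉ : w ∉ block
      w∉ w∈ = x∉ (path⊆block eq (ancestor-∈-path desc (block⊆path eq w∈)))
      w∉p : w ∉ path α
      w∉p w∈p = w∉ (path⊆block eq w∈p)
      beyond : Dec (u ∈ block) → delay u (path α ++ flat αs) ≤ delay w (path α ++ flat αs)
      beyond (yes u∈) = <⇒≤ (delay-++-< (block⊆path eq u∈) w∉p)
      beyond (no u∉) = delay-++-mono {xs = path α} (u∉ ∘ path⊆block eq) w∉p
        (islru-order hist desc (delay-++-mono⁻ {xs = block} w∉ x∉ w≤x) (delay-++-mono⁻ {xs = block} u∉ x∉ u≤x) lowest)

  -- Listing the paths root first changes the recency order only between nodes whose latest accesses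
  -- belong to the same translation, and these are comparable in the tree.
  flat-order : ∀ {αs old} → History αs old → x ∈ flat αs → delay x (flat αs) ≤ delay y (flat αs) →
    delay x old < delay y old ⊎ y ⊑ x
  flat-order {x} {y} (_∷_ {α} {αs} {block} {old} eq hist) x∈ x≤y = by-cases (x ∈? path α) (y ∈? path α)
    where
    later : x ∉ path α → x ∈ path α ⊎ x ∈ flat αs → x ∈ flat αs
    later x∉p (inj₁ x∈p)  = contradiction x∈p x∉p
    later _   (inj₂ x∈αs) = x∈αs
    by-cases : Dec (x ∈ path α) → Dec (y ∈ path α) → delay x (block ++ old) < delay y (block ++ old) ⊎ y ⊑ x
    by-cases (yes x∈p) (yes y∈p) =
      inj₂ (path-chain y∈p x∈p (path-order⁻ x∈p y∈p (subst₂ _≤_ (delay-++-∈ x∈p) (delay-++-∈ y∈p) x≤y)))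
    by-cases (yes x∈p) (no y∉p)  = inj₁ (delay-++-< {xs = block} (path⊆block eq x∈p) (y∉p ∘ block⊆path eq))
    by-cases (no x∉p)  (yes y∈p) = contradiction x≤y (<⇒≱ (delay-++-< y∈p x∉p))
    by-cases (no x∉p)  (no y∉p)  = Sum.map₁
      (subst₂ _<_ (sym (delay-++-∉ {xs = block} (x∉p ∘ block⊆path eq))) (sym (delay-++-∉ {xs = block} (y∉p ∘ block⊆path eq)))
        ∘ +-monoʳ-< (length block))
      (flat-order hist (later x∉p (∈-++⁻ (path α) x∈)) (delay-++-mono⁻ {xs = path α} x∉p y∉p x≤y))

  -- Suppose LRU holds a node `y` of the next path that ISLRU lacks. Then ISLRU is full, and each
  -- node it holds beyond LRU is an ancestor of `y`, hence on the path. So `I` lies in the union of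
  -- `L` and the path, and `misses-union` applies.
  round-start : ∀ {βs old I L s} → History βs old → Unique I → length L ≤ s → L ⊆ old →
    Recency (flat βs) I → Recency old L → I ⊆ flat βs → Saturated s (flat βs) I →
    ∀ α → misses I (path α) ≤ misses L (path α)
  round-start {I = I} {L} {s} hist uI L≤s L⊆ recI recL I⊆ sat α = misses-compare {C = I} {L} uI (path-unique α) λ y∈p y∈L y∉I →
    L≤I y∈L y∉I sat , λ x∈I → place y∈p y∈L y∉I x∈I (_ ∈? L)
    where
    L≤I : y ∈ L → y ∉ I → Saturated s _ I → length L ≤ length I
    L≤I _ _ (inj₁ full) = ≤-trans L≤s full
    L≤I y∈L y∉I (inj₂ all) = contradiction (all (old⊆flat hist (L⊆ y∈L))) y∉I
    place : y ∈ path α → y ∈ L → y ∉ I → x ∈ I → Dec (x ∈ L) → x ∈ L ⊎ x ∈ path α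
    place _ _ _ _ (yes x∈L) = inj₁ x∈L
    place y∈p y∈L y∉I x∈I (no x∉L) with flat-order hist (I⊆ x∈I) (recI x∈I y∉I)
    ... | inj₁ x<y  = contradiction (recL y∈L x∉L) (<⇒≱ x<y)
    ... | inj₂ desc = inj₂ (ancestor-∈-path desc y∈p)

  -- This is the initial segment property along the current path: below a missing node nothing is
  -- cached, because in the rearranged history an ancestor is never older than its descendant.
  islru-spares-path : ∀ {βs α done v rem I z} → done ʳ++ (v ∷ rem) ≡ path α →
    Recency (done ++ flat βs) I → I ⊆ done ++ flat βs → done ⊆ I → v ∉ I → z ∈ I → z ∉ rem
  islru-spares-path {βs} {α} {done} {v} {rem} {I} {z} split rec I⊆ done⊆ v∉I z∈I z∈rem =
    v∉I (subst (_∈ I) (delay-injective z∈flat (≤-antisym z≤v (delay-flat-mono βs desc))) z∈I)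
    where
    v∉done : v ∉ done
    v∉done v∈ = v∉I (done⊆ v∈)
    z∉done : z ∉ done
    z∉done z∈ = done⇒∉rem {done = done} split z∈ (there z∈rem)
    z∈flat : z ∈ flat βs
    z∈flat with ∈-++⁻ done (I⊆ z∈I)
    ... | inj₁ z∈done = contradiction z∈done z∉done
    ... | inj₂ z∈f    = z∈f
    z≤v : delay z (flat βs) ≤ delay v (flat βs)
    z≤v = delay-++-mono⁻ z∉done v∉done (rec z∈I v∉I)
    desc : z ⊑ v
    desc = path-chain (rem⊆path {done = v ∷ done} split z∈rem) (done⊆path {done = v ∷ done} split (here refl))
             (done-above-rem {done = v ∷ done} split (here refl) z∈rem)

  -- Why ISMIN loses nothing by evicting only nodes without cached descendants:
  -- the lowest descendants of a node off the path are not needed before the node.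
  module _ {α : Address} {F rem : List Node} {αs : List Address} (F≡ : F ≡ rem ++ flat αs) (rem⊆ : rem ⊆ path α) where

    private
      mono : w ⊑ u → u ∉ path α → w ∉ path α → delay u F ≤ delay w F
      mono {w} {u} desc u∉ w∉ = subst (λ F → delay u F ≤ delay w F) (sym F≡)
        (delay-++-mono (u∉ ∘ rem⊆) (w∉ ∘ rem⊆) (delay-flat-mono αs desc))

      Later : Node → Node → Set
      Later u x = x ∉ path α × delay u F ≤ delay x F

      Later? : ∀ u → Decidable (Later u)
      Later? u x = ¬? (x ∈? path α) ×-dec (delay u F ≤? delay x F)

    lowest-below : ∀ {M} → u ∈ M → u ∉ path α →
      ∃ λ x → x ∈ M × x ∉ path α × delay u F ≤ delay x F × (∀ {w} → w ∈ M → w ⊑ x → layer x ≤ layer w)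
    lowest-below {u} {M} u∈ u∉ = low , proj₁ props , proj₁ (proj₂ props) , proj₂ (proj₂ props) , minimal
      where
      pool : List Node
      pool = filter (Later? u) M
      low : Node
      -- The default `u` satisfies the conditions of the pool itself.
      low = argmin layer u pool
      props : low ∈ M × Later u low
      props = argmin-all layer (u∈ , u∉ , ≤-refl) (All.tabulate λ y∈ → ∈-filter⁻ (Later? u) y∈)
      minimal : ∀ {w} → w ∈ M → w ⊑ low → layer low ≤ layer w
      -- A cached descendant of `low` is again off the path and needed no sooner, so it competes in
      -- the pool.
      minimal {w} w∈ desc = All.lookup (f[argmin]≤f[xs] u pool)
        (∈-filter⁺ (Later? u) w∈ (w∉ , ≤-trans (proj₂ (proj₂ props)) (mono desc (proj₁ (proj₂ props)) w∉)))
        where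
        w∉ : w ∉ path α
        w∉ w∈p = proj₁ (proj₂ props) (ancestor-∈-path desc w∈p)

    sooner-on-path : u ∈ rem → z ∉ path α → delay u F ≤ delay z F
    sooner-on-path {u} {z} u∈ z∉ = subst (λ F → delay u F ≤ delay z F) (sym F≡) (<⇒≤ (delay-++-< u∈ (z∉ ∘ rem⊆)))

  -- The path has `suc height` nodes and one of them, `v`, is missing. Adding `v` to `M` therefore
  -- gives more nodes than the path has.
  off-path-cached : ∀ {α M} → v ∈ path α → v ∉ M → Unique M → height < length M → ∃ λ x → x ∈ M × x ∉ path α
  off-path-cached {v} {α} {M} v∈ v∉M uM h<M =
    let x , x∈ , x∉ = pigeonhole _≟_ {xs = v ∷ M} {ys = path α} (All.tabulate (λ { x∈ refl → v∉M x∈ }) ∷ uM)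
                        (s≤s (≤-trans (≤-reflexive (path-length α)) h<M))
    in x , cached x∈ x∉ , x∉
    where
    cached : x ∈ v ∷ M → x ∉ path α → x ∈ M
    cached (here refl) x∉ = contradiction v∈ x∉
    cached (there x∈)  _  = x∈

  -- As `v` is still pending, `done` has at most `height` nodes and cannot exhaust the cache. So
  -- `top` lies outside `done`, and by `done-closed` so does its descendant `z`. Behind `done`,
  -- `islru-order` decides.
  islru-furthest : ∀ {βs old α done v rem I top} → History βs old →
    done ʳ++ (v ∷ rem) ≡ path α → Unique I → height < length I →
    (∀ u → u ∈ I → delay u (done ++ old) ≤ delay top (done ++ old)) →
    z ∈ I → z ⊑ top → (∀ u → u ∈ I × u ⊑ top → layer z ≤ layer u) →
    Furthest (done ++ flat βs) I z × z ∉ done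
  islru-furthest {z} {βs} {old} {α} {done} {v} {rem} {I} {top} hist split uI h<I oldest z∈ desc lowest =
    (z∈ , λ {u} u∈ → furthest u∈ (u ∈? done)) , z∉
    where
    done-short : length done < length I
    done-short = begin-strict
      length done              ≤⟨ m≤m+n _ (length rem) ⟩
      length done + length rem ≡⟨ suc-injective (trans (sym (+-suc _ _)) (done+rem {done = done} split)) ⟩
      height                   <⟨ h<I ⟩
      length I                 ∎
      where open ≤-Reasoning
    top∉ : top ∉ done
    top∉ top∈ = let u , u∈I , u∉ = pigeonhole _≟_ uI done-short
                in <⇒≱ (delay-++-< top∈ u∉) (oldest u u∈I)
    z∉ : z ∉ done
    z∉ z∈done = top∉ (done-closed {done = done} split desc z∈done)
    furthest : u ∈ I → Dec (u ∈ done) → delay u (done ++ flat βs) ≤ delay z (done ++ flat βs)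
    furthest u∈ (yes u∈done) = <⇒≤ (delay-++-< u∈done z∉)
    furthest {u} u∈ (no u∉) = delay-++-mono u∉ z∉
      (islru-order hist desc (delay-++-mono⁻ z∉ top∉ (oldest z z∈))
                             (delay-++-mono⁻ u∉ top∉ (oldest u u∈))
                             λ desc-u → lowest u (u∈ , desc-u))

  module _ {α : Address} {βs : List Address} {done I : List Node} (eq : reverse done ≡ path α) where

    round-end-⊆ : I ⊆ done ++ flat βs → I ⊆ path α ++ flat βs
    round-end-⊆ I⊆ x∈ with ∈-++⁻ done (I⊆ x∈)
    ... | inj₁ x∈done = ∈-++⁺ˡ (block⊆path eq x∈done)
    ... | inj₂ x∈flat = ∈-++⁺ʳ (path α) x∈flat

    -- Reversing the finished path permutes nodes that are all cached, whereas `Recency` compares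
    -- cached nodes with uncached ones.
    round-end-recency : done ⊆ I → Recency (done ++ flat βs) I → Recency (path α ++ flat βs) I
    round-end-recency done⊆ rec {x} {y} x∈ y∉ = arrange (x ∈? path α)
      where
      y∉done : y ∉ done
      y∉done y∈ = y∉ (done⊆ y∈)
      y∉path : y ∉ path α
      y∉path y∈ = y∉done (path⊆block eq y∈)
      arrange : Dec (x ∈ path α) → delay x (path α ++ flat βs) ≤ delay y (path α ++ flat βs)
      arrange (yes x∈p) = <⇒≤ (delay-++-< x∈p y∉path)
      arrange (no x∉p) = delay-++-mono x∉p y∉path (delay-++-mono⁻ {xs = done} (x∉p ∘ block⊆path eq) y∉done (rec x∈ y∉))

    round-end-saturated : ∀ {s} → Saturated s (done ++ flat βs) I → Saturated s (path α ++ flat βs) I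
    round-end-saturated = Sum.map₂ (λ all x∈ → all (reorder (∈-++⁻ (path α) x∈)))
      where
      reorder : x ∈ path α ⊎ x ∈ flat βs → x ∈ done ++ flat βs
      reorder (inj₁ x∈p) = ∈-++⁺ˡ (path⊆block {block = done} eq x∈p)
      reorder (inj₂ x∈f) = ∈-++⁺ʳ done x∈f

-- Translation caches as an instance of paging

module Caching (K P d : ℕ) (K≥2 : 2 ≤ K) (P≥1 : 1 ≤ P) where

  open Translation K P d K≥2 P≥1 hiding (delay)
  open Paging _≟ᴺ_
  open import Data.List.Membership.DecPropositional _≟ᴺ_ using (_∈?_)

  situation : List Node → List Node → Address → Node → List Request → Situation
  situation past C α v rest =
    record { past = past ; content = C ; address = α ; future = v ∷ map proj₂ rest }

  private variable
    u w x y : Node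
    s : ℕ

  room-free : ∀ π σ → length (content σ) < s → makeRoom π s σ ≡ content σ
  room-free {s} π σ lt rewrite dec-true (length (content σ) <? s) lt = refl

  room-full : ∀ π σ → ¬ length (content σ) < s → makeRoom π s σ ≡ content σ ─ π σ
  room-full {s} π σ ≮ rewrite dec-false (length (content σ) <? s) ≮ = refl

  -- Isolates the case analysis of `insertionsFrom`. The miss and the full cache are handed to
  -- `victim` because the existence of an ISMIN candidate depends on them.
  step : ∀ π s past C α v rest {V} →
         (v ∉ C → s ≤ length C → V (π (situation past C α v rest))) →
         ∃₂ λ C′ n → Step s v V C C′ n ×
           insertionsFrom π s past C ((α , v) ∷ rest) ≡ n + insertionsFrom π s (v ∷ past) C′ rest
  step π s past C α v rest victim with v ∈? C
  ... | yes v∈C = _ , _ , hit v∈C , refl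
  ... | no v∉C with length C <? s
  ... | yes lt = _ , _ , free v∉C lt ,
    cong (λ D → suc (insertionsFrom π s (v ∷ past) (v ∷ D) rest)) (room-free π (situation past C α v rest) lt)
  ... | no ≮   = _ , _ , evict _ v∉C (≮⇒≥ ≮) (victim v∉C (≮⇒≥ ≮)) ,
    cong (λ D → suc (insertionsFrom π s (v ∷ past) (v ∷ D) rest)) (room-full π (situation past C α v rest) ≮)

  -- Translation paths

  node-≡ : ∀ {x y : Node} → layer x ≡ layer y → index x ≡ index y → x ≡ y
  node-≡ refl refl = refl

  layer-≤ : ∀ x → layer x ≤ d
  -- The bound is an irrelevant field, so it is recovered by deciding it.
  layer-≤ (node ℓ _ ℓ≤d _) = recompute (ℓ ≤? d) ℓ≤d

  path-injective : ∀ {α} i j → pathNode α (opposite i) ≡ pathNode α (opposite j) → i ≡ j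
  path-injective i j eq = begin
    i                      ≡⟨ opposite-involutive i ⟨
    opposite (opposite i)  ≡⟨ cong opposite (toℕ-injective (cong layer eq)) ⟩
    opposite (opposite j)  ≡⟨ opposite-involutive j ⟩
    j                      ∎
    where open ≡-Reasoning

  path-unique : ∀ α → Unique (path α)
  path-unique α = Unique.tabulate⁺ {f = pathNode α ∘ opposite} λ {i} {j} → path-injective {α} i j

  path-length : ∀ α → length (path α) ≡ suc d
  path-length α = length-tabulate (pathNode α ∘ opposite)

  ∈-path⁺ : ∀ {α} ℓ → pathNode α ℓ ∈ path α
  ∈-path⁺ {α} ℓ = subst (λ i → pathNode α i ∈ path α) (opposite-involutive ℓ) (∈-tabulate⁺ {f = pathNode α ∘ opposite} (opposite ℓ))

  ∈-path⁻ : ∀ {α} → x ∈ path α → ∃ λ ℓ → x ≡ pathNode α ℓ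
  ∈-path⁻ {α = α} x∈ = let i , eq = ∈-tabulate⁻ {f = pathNode α ∘ opposite} x∈ in opposite i , eq

  delay-tabulate : ∀ {n} (f : Fin n → Node) → (∀ i j → f i ≡ f j → i ≡ j) →
                   ∀ i → delay (f i) (tabulate f) ≡ toℕ i
  delay-tabulate f inj zero = delay-here (f zero) _
  delay-tabulate f inj (suc i) =
    trans (delay-there {xs = tabulate (f ∘ suc)} λ eq → case inj (suc i) zero eq of λ ())
          (cong suc (delay-tabulate (f ∘ suc) (λ j k eq → Fin-suc-injective (inj (suc j) (suc k) eq)) i))

  delay-path : ∀ {α} → x ∈ path α → delay x (path α) + layer x ≡ d
  delay-path {α = α} x∈ with ∈-tabulate⁻ {f = pathNode α ∘ opposite} x∈
  ... | i , refl = begin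
    delay (pathNode α (opposite i)) (path α) + toℕ (opposite i)
      ≡⟨ cong₂ _+_ (delay-tabulate (pathNode α ∘ opposite) path-injective i) (opposite-prop i) ⟩
    toℕ i + (d ∸ toℕ i)                                        ≡⟨ m+[n∸m]≡n (s≤s⁻¹ (toℕ<n i)) ⟩
    d                                                          ∎
    where open ≡-Reasoning

  private instance
    K≢0 : NonZero K
    K≢0 = >-nonZero (<⇒≤ K≥2)

  pathIndex-suc : ∀ α ℓ → pathIndex α (suc ℓ) ≡ pathIndex α ℓ DivMod./ K
  pathIndex-suc α ℓ = begin
    pathIndex α (suc ℓ)                     ≡⟨ DivMod./-congʳ {{spanNonZero (suc ℓ)}} {{span*K}} eq ⟩
    DivMod._/_ (toℕ α) (P * K ^ ℓ * K) {{span*K}} ≡⟨ DivMod.m/n/o≡m/[n*o] (toℕ α) (P * K ^ ℓ) K {{spanNonZero ℓ}} {{K≢0}} {{span*K}} ⟨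
    pathIndex α ℓ DivMod./ K                ∎
    where
    open ≡-Reasoning
    span*K : NonZero (P * K ^ ℓ * K)
    span*K = m*n≢0 (P * K ^ ℓ) K {{spanNonZero ℓ}}
    eq : P * K ^ suc ℓ ≡ P * K ^ ℓ * K
    eq = trans (cong (P *_) (*-comm K (K ^ ℓ))) (sym (*-assoc P (K ^ ℓ) K))

  pathNode-◁ : ∀ {α} ℓ m → toℕ m ≡ suc (toℕ ℓ) → pathNode α ℓ ◁ pathNode α m
  -- The child number is the remainder of the index modulo `K`.
  pathNode-◁ {α} ℓ m eq = eq , a , (begin
    q                                              ≡⟨ DivMod.m≡m%n+[m/n]*n q K ⟩
    q DivMod.% K + q DivMod./ K * K                ≡⟨ +-comm (q DivMod.% K) _ ⟩
    q DivMod./ K * K + q DivMod.% K                ≡⟨ cong₂ _+_ (*-comm (q DivMod./ K) K) (sym (toℕ-fromℕ< (DivMod.m%n<n q K))) ⟩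
    K * (q DivMod./ K) + toℕ a ≡⟨ cong (λ i → K * i + toℕ a) (pathIndex-suc α (toℕ ℓ)) ⟨
    K * pathIndex α (suc (toℕ ℓ)) + toℕ a            ≡⟨ cong (λ j → K * pathIndex α j + toℕ a) eq ⟨
    K * pathIndex α (toℕ m) + toℕ a               ∎)
    where
    open ≡-Reasoning
    q : ℕ
    q = pathIndex α (toℕ ℓ)
    a : Fin K
    a = fromℕ< (DivMod.m%n<n q K)

  -- The child number is less than `K`, so division by `K` recovers the index of the parent.
  parent-unique : ∀ {c p q} → c ◁ p → c ◁ q → p ≡ q
  parent-unique {c} {p} {q} (lp , a , ip) (lq , b , iq) =
    node-≡ (trans lp (sym lq)) (trans (quotient p a ip) (sym (quotient q b iq)))
    where
    open ≡-Reasoning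
    quotient : ∀ r (a : Fin K) → index c ≡ K * index r + toℕ a → index r ≡ index c DivMod./ K
    quotient r a eq = sym (begin
      index c DivMod./ K                            ≡⟨ cong (DivMod._/ K) (trans eq (cong (_+ toℕ a) (*-comm K (index r)))) ⟩
      (index r * K + toℕ a) DivMod./ K              ≡⟨ DivMod.+-distrib-/-∣ˡ (toℕ a) (divides (index r) refl) ⟩
      index r * K DivMod./ K + toℕ a DivMod./ K     ≡⟨ cong₂ _+_ (DivMod.m*n/n≡m (index r) K) (DivMod.m<n⇒m/n≡0 (toℕ<n a)) ⟩
      index r + 0                                   ≡⟨ +-identityʳ _ ⟩
      index r                                       ∎)

  parent-∈-path : ∀ {α c p} → c ◁ p → c ∈ path α → p ∈ path α
  parent-∈-path {α} {c} {p} c◁p c∈ with ∈-path⁻ c∈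
  ... | ℓ , refl = subst (_∈ path α) (parent-unique {pathNode α ℓ} {pathNode α m} {p} (pathNode-◁ {α} ℓ m toℕ-m) c◁p) (∈-path⁺ m)
    where
    bound : suc (toℕ ℓ) < suc d
    bound = s≤s (subst (_≤ d) (proj₁ c◁p) (layer-≤ p))
    m : Fin (suc d)
    m = fromℕ< bound
    toℕ-m : toℕ m ≡ suc (toℕ ℓ)
    toℕ-m = toℕ-fromℕ< bound

  ancestor-∈-path : ∀ {α} → DescendantOrSelf w x → w ∈ path α → x ∈ path α
  ancestor-∈-path ε        w∈ = w∈
  ancestor-∈-path (c ◅ cs) w∈ = ancestor-∈-path cs (parent-∈-path c w∈)

  layer-mono : DescendantOrSelf w x → layer w ≤ layer x
  layer-mono ε = ≤-refl
  layer-mono (c ◅ cs) = ≤-trans (≤-trans (n≤1+n _) (≤-reflexive (sym (proj₁ c)))) (layer-mono cs)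

  proper⇒descendant : ProperDescendant w x → DescendantOrSelf w x
  proper⇒descendant TC.[ c ] = c ◅ ε
  proper⇒descendant (c TC.∷ cs) = c ◅ proper⇒descendant cs

  layer-strict : ProperDescendant w x → layer w < layer x
  layer-strict TC.[ c ] = ≤-reflexive (sym (proj₁ c))
  layer-strict (c TC.∷ cs) = ≤-trans (≤-reflexive (sym (proj₁ c))) (<⇒≤ (layer-strict cs))

  path-chain : ∀ {α w x} → w ∈ path α → x ∈ path α → layer w ≤ layer x → DescendantOrSelf w x
  path-chain {α} w∈ x∈ w≤x with ∈-path⁻ w∈ | ∈-path⁻ x∈
  ... | ℓ , refl | m , refl = climb (toℕ m ∸ toℕ ℓ) ℓ (sym (m∸n+n≡m w≤x))
    where
    climb : ∀ k ℓ → toℕ m ≡ k + toℕ ℓ → DescendantOrSelf (pathNode α ℓ) (pathNode α m)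
    climb zero ℓ eq with toℕ-injective eq
    ... | refl = ε
    climb (suc k) ℓ eq = pathNode-◁ {α} ℓ next toℕ-next ◅ climb k next
      (trans eq (trans (sym (+-suc k (toℕ ℓ))) (cong (k +_) (sym toℕ-next))))
      where
      bound : suc (toℕ ℓ) < suc d
      bound = ≤-<-trans (≤-trans (s≤s (m≤n+m (toℕ ℓ) k)) (≤-reflexive (sym eq))) (toℕ<n m)
      next : Fin (suc d)
      next = fromℕ< bound
      toℕ-next : toℕ next ≡ suc (toℕ ℓ)
      toℕ-next = toℕ-fromℕ< bound

  tree : PathSystem
  tree = record
    { Node = Node ; Address = Address ; _≟_ = _≟ᴺ_ ; path = path ; height = d ; layer = layer ; _⊑_ = DescendantOrSelf
    ; path-unique = path-unique ; path-length = path-length ; delay-path = delay-path ; layer-mono = layer-mono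
    ; ancestor-∈-path = ancestor-∈-path ; path-chain = path-chain }

  open Rounds tree public

  -- Requests from the middle of a translation onwards

  upcoming : Address → List Node → List Address → List Request
  upcoming α rem αs = map (α ,_) rem ++ requests αs

  map-proj₂ : ∀ (α : Address) (xs : List Node) → map proj₂ (map (α ,_) xs) ≡ xs
  map-proj₂ α [] = refl
  map-proj₂ α (x ∷ xs) = cong (x ∷_) (map-proj₂ α xs)

  requests-flat : ∀ αs → map proj₂ (requests αs) ≡ flat αs
  requests-flat [] = refl
  requests-flat (α ∷ αs) = trans (map-++ proj₂ (map (α ,_) (path α)) (requests αs))
    (cong₂ _++_ (map-proj₂ α (path α)) (requests-flat αs))

  upcoming-flat : ∀ α rem αs → map proj₂ (upcoming α rem αs) ≡ rem ++ flat αs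
  upcoming-flat α rem αs = trans (map-++ proj₂ (map (α ,_) rem) (requests αs)) (cong₂ _++_ (map-proj₂ α rem) (requests-flat αs))

  -- Nodes off the path have a candidate that is needed no sooner, and the pending path nodes are
  -- needed before all candidates. Only completed path nodes escape the comparison; they are the
  -- pinned ones in `exchange`.
  ismin-victim : ∀ {π s α done v rem M past αs} → IsISMIN π → d < s → done ʳ++ (v ∷ rem) ≡ path α →
    Unique M → v ∉ M → s ≤ length M →
    let σ = situation past M α v (upcoming α rem αs) in
    π σ ∈ M × (∀ {u} → u ∈ M → u ∈ done ⊎ delay u (future σ) ≤ delay (π σ) (future σ))
  ismin-victim {π} {s} {α} {done} {v} {rem} {M} {past} {αs} ismin d<s split uM v∉M full =
    proj₁ (proj₁ choice) , λ u∈ → compare u∈ (_ ∈? path α)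
    where
    σ : Situation
    σ = situation past M α v (upcoming α rem αs)

    future-eq : future σ ≡ (v ∷ rem) ++ flat αs
    future-eq = cong (v ∷_) (upcoming-flat α rem αs)

    rem⊆ : v ∷ rem ⊆ path α
    rem⊆ = rem⊆path {done = done} split

    candidate-below : u ∈ M → u ∉ path α → ∃ λ x → ISMINCandidate σ x × delay u (future σ) ≤ delay x (future σ)
    candidate-below u∈ u∉ =
      let x , x∈ , x∉ , u≤x , lowest = lowest-below {αs = αs} future-eq rem⊆ u∈ u∉
      in x , (x∈ , x∉ , λ (w , w∈ , desc) → <⇒≱ (layer-strict desc) (lowest w∈ (proper⇒descendant desc))) , u≤x

    exists : ∃ (ISMINCandidate σ)
    exists = let x , x∈ , x∉ = off-path-cached (rem⊆ (here refl)) v∉M uM (<-≤-trans d<s full)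
                 y , candidate , _ = candidate-below x∈ x∉
             in y , candidate

    choice : FurthestInFuture σ (ISMINCandidate σ) (π σ)
    choice = ismin σ exists

    compare : u ∈ M → Dec (u ∈ path α) → u ∈ done ⊎ delay u (future σ) ≤ delay (π σ) (future σ)
    compare u∈M (no u∉) =
      let x , candidate , u≤x = candidate-below u∈M u∉ in inj₂ (≤-trans u≤x (proj₂ choice x candidate))
    compare u∈M (yes u∈) =
      Sum.map₂ (λ u∈rem → sooner-on-path {αs = αs} future-eq rem⊆ u∈rem (proj₁ (proj₂ (proj₁ choice)))) (path⊆ {done = done} split u∈)

  -- The four inequalities by induction on the requests

  cache-nonempty : ∀ {C : List Node} → 0 < length C → ∃ (_∈ C)
  cache-nonempty {x ∷ _} _ = x , here refl

  settle : ∀ {a b a′ b′ m n k k′} → a ≡ m + a′ → b ≡ n + b′ → m + k′ ≡ k + n → a′ ≤ b′ + k′ → a ≤ b + k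
  settle {a′ = a′} {b′} {m} {n} {k} {k′} refl refl eq le = begin
    m + a′          ≤⟨ +-monoʳ-≤ m le ⟩
    m + (b′ + k′)   ≡⟨ solve 3 (λ m b k → m :+ (b :+ k) := (m :+ k) :+ b) refl m b′ k′ ⟩
    m + k′ + b′     ≡⟨ cong (_+ b′) eq ⟩
    k + n + b′      ≡⟨ solve 3 (λ k n b → k :+ n :+ b := n :+ b :+ k) refl k n b′ ⟩
    n + b′ + k      ∎
    where
    open ≤-Reasoning
    open +-*-Solver

  -- Nothing is pinned here. The position in the path serves to show that ISMIN has a candidate, so
  -- that its victim is a cached node.
  min≤ismin : ∀ {MIN ISMIN s} → IsMIN MIN → IsISMIN ISMIN → d < s →
    ∀ αs α done rem past M C k → done ʳ++ rem ≡ path α → Unique M → Unique C → length C ≤ s →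
    Dominates k (map proj₂ (upcoming α rem αs)) C M →
    insertionsFrom MIN s past M (upcoming α rem αs) ≤ insertionsFrom ISMIN s past C (upcoming α rem αs) + k
  min≤ismin isMin isIsmin d<s [] α done [] past M C k split uM uC C≤s dom = z≤n
  min≤ismin isMin isIsmin d<s (β ∷ αs) α done [] past M C k split uM uC C≤s dom =
    min≤ismin isMin isIsmin d<s αs β [] (path β) past M C k refl uM uC C≤s dom
  min≤ismin {MIN} {ISMIN} {s} isMin isIsmin d<s αs α done (v ∷ rem) past M C k split uM uC C≤s dom =
    combine
      (step MIN s past M α v rest λ _ full →
        let z∈ , far = isMin _ (cache-nonempty (<-≤-trans (≤-<-trans z≤n d<s) full)) in z∈ , λ {u} u∈ → inj₂ (far u u∈))
      (step ISMIN s past C α v rest λ v∉C full →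
        proj₁ (ismin-victim {done = done} {αs = αs} isIsmin d<s split uC v∉C full) , λ ())
    where
    rest : List Request
    rest = upcoming α rem αs
    F : List Node
    F = map proj₂ rest
    combine :
      ∃₂ (λ M′ m → Step s v (λ z → z ∈ M × (∀ {u} → u ∈ M → u ∈ [] ⊎ delay u (v ∷ F) ≤ delay z (v ∷ F))) M M′ m ×
        insertionsFrom MIN s past M ((α , v) ∷ rest) ≡ m + insertionsFrom MIN s (v ∷ past) M′ rest) →
      ∃₂ (λ C′ n → Step s v (λ z → z ∈ C × z ∉ []) C C′ n ×
        insertionsFrom ISMIN s past C ((α , v) ∷ rest) ≡ n + insertionsFrom ISMIN s (v ∷ past) C′ rest) →
      insertionsFrom MIN s past M ((α , v) ∷ rest) ≤ insertionsFrom ISMIN s past C ((α , v) ∷ rest) + k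
    combine (M′ , m , stM , eqM) (C′ , n , stC , eqC) =
      let k′ , paid , dom′ = exchange stM stC uM uC C≤s (λ ()) dom in
      settle eqM eqC paid
        -- `(v ∷ done) ʳ++ rem` reduces to `done ʳ++ (v ∷ rem)`, so `split` carries over unchanged.
        (min≤ismin isMin isIsmin d<s αs α (v ∷ done) rem (v ∷ past) M′ C′ k′ split
          (step-unique stM uM) (step-unique stC uC) (step-length stC proj₁ uC C≤s) dom′)

  islru-victim : ∀ {π s βs old α done v rem I rest} → IsISLRU π → d < s → History βs old →
    done ʳ++ (v ∷ rem) ≡ path α → Unique I → s ≤ length I →
    let z = π (situation (done ++ old) I α v rest) in
    Furthest (done ++ flat βs) I z × z ∉ done
  islru-victim {done = done} islru d<s hist split uI full =
    let top , (_ , oldest) , (z∈ , desc) , lowest = islru _ (cache-nonempty (<-≤-trans (≤-<-trans z≤n d<s) full))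
    in islru-furthest {done = done} hist split uI (<-≤-trans d<s full) oldest z∈ desc lowest

  -- The pinned nodes are `done`: ISLRU never evicts a node already accessed in the current
  -- translation. The set is empty again when a translation starts.
  ismin≤islru : ∀ {ISMIN ISLRU s} → IsISMIN ISMIN → IsISLRU ISLRU → d < s →
    ∀ αs α done rem βs old M C k → History βs old → done ʳ++ rem ≡ path α → Unique M → Unique C → length C ≤ s →
    done ⊆ C → Dominates k (map proj₂ (upcoming α rem αs)) C M →
    insertionsFrom ISMIN s (done ++ old) M (upcoming α rem αs) ≤ insertionsFrom ISLRU s (done ++ old) C (upcoming α rem αs) + k
  ismin≤islru isIsmin isIslru d<s [] α done [] βs old M C k hist split uM uC C≤s done⊆ dom = z≤n
  ismin≤islru isIsmin isIslru d<s (γ ∷ αs) α done [] βs old M C k hist split uM uC C≤s done⊆ dom =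
    -- `done ʳ++ []` is `reverse done`, so `split` also enters the finished path into the history.
    ismin≤islru isIsmin isIslru d<s αs γ [] (path γ) (α ∷ βs) (done ++ old) M C k (split ∷ hist) refl uM uC C≤s (λ ()) dom
  ismin≤islru {ISMIN} {ISLRU} {s} isIsmin isIslru d<s αs α done (v ∷ rem) βs old M C k hist split uM uC C≤s done⊆ dom =
    combine
      (step ISMIN s (done ++ old) M α v rest (ismin-victim {done = done} {αs = αs} isIsmin d<s split uM))
      (step ISLRU s (done ++ old) C α v rest λ _ full →
        let (z∈ , _) , z∉ = islru-victim {done = done} isIslru d<s hist split uC full in z∈ , z∉)
    where
    rest : List Request
    rest = upcoming α rem αs
    F : List Node
    F = map proj₂ rest
    combine :
      ∃₂ (λ M′ m → Step s v (λ z → z ∈ M × (∀ {u} → u ∈ M → u ∈ done ⊎ delay u (v ∷ F) ≤ delay z (v ∷ F))) M M′ m ×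
        insertionsFrom ISMIN s (done ++ old) M ((α , v) ∷ rest) ≡ m + insertionsFrom ISMIN s (v ∷ done ++ old) M′ rest) →
      ∃₂ (λ C′ n → Step s v (λ z → z ∈ C × z ∉ done) C C′ n ×
        insertionsFrom ISLRU s (done ++ old) C ((α , v) ∷ rest) ≡ n + insertionsFrom ISLRU s (v ∷ done ++ old) C′ rest) →
      insertionsFrom ISMIN s (done ++ old) M ((α , v) ∷ rest) ≤ insertionsFrom ISLRU s (done ++ old) C ((α , v) ∷ rest) + k
    combine (M′ , m , stM , eqM) (C′ , n , stC , eqC) =
      let k′ , paid , dom′ = exchange stM stC uM uC C≤s done⊆ dom in
      settle eqM eqC paid
        (ismin≤islru isIsmin isIslru d<s αs α (v ∷ done) rem βs old M′ C′ k′ hist split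
          (step-unique stM uM) (step-unique stC uC) (step-length stC proj₁ uC C≤s)
          (λ { (here refl) → v∈step stC ; (there x∈) → step-survives stC (done⊆ x∈) λ _ _ (_ , x∉) → x∉ x∈ }) dom′)

  lockstep : ∀ {a b a′ b′ m n p q} → a ≡ m + a′ → b ≡ n + b′ → p + m + a′ ≤ q + n + b′ → p + a ≤ q + b
  lockstep {a′ = a′} {b′} {m} {n} {p} {q} refl refl le = subst₂ _≤_ (+-assoc p m a′) (+-assoc q n b′) le

  -- p and q are the insertions already made by ISLRU and LRU.
  islru≤lru : ∀ {ISLRU LRU s} → IsISLRU ISLRU → IsLRU LRU → d < s →
    ∀ αs α done rem βs old I L p q → History βs old → done ʳ++ rem ≡ path α →
    Unique I → Unique L → length L ≤ s → L ⊆ done ++ old → I ⊆ done ++ flat βs → done ⊆ I →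
    Recency (done ++ flat βs) I → Recency (done ++ old) L → Saturated s (done ++ flat βs) I →
    p + misses I rem ≤ q + misses L rem →
    p + insertionsFrom ISLRU s (done ++ old) I (upcoming α rem αs) ≤ q + insertionsFrom LRU s (done ++ old) L (upcoming α rem αs)
  -- No requests and no path nodes remain, so both sides of `le` already agree with the goal.
  islru≤lru isIslru isLru d<s [] α done [] βs old I L p q hist split uI uL L≤s L⊆ I⊆ done⊆ recI recL sat le = le
  islru≤lru {s = s} isIslru isLru d<s (γ ∷ αs) α done [] βs old I L p q hist split uI uL L≤s L⊆ I⊆ done⊆ recI recL sat le =
    islru≤lru isIslru isLru d<s αs γ [] (path γ) (α ∷ βs) (done ++ old) I L p q (split ∷ hist) refl uI uL L≤s L⊆
      I⊆′ (λ ()) recI′ recL sat′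
      -- At the end of a path `le` says `p ≤ q`, and `round-start` compares the misses on the next
      -- path.
      (+-mono-≤ (subst₂ _≤_ (+-identityʳ p) (+-identityʳ q) le)
                (round-start {I = I} {L} (split ∷ hist) uI L≤s L⊆ recI′ recL I⊆′ sat′ γ))
    where
    I⊆′ : I ⊆ flat (α ∷ βs)
    I⊆′ = round-end-⊆ {βs = βs} {done = done} split I⊆
    recI′ : Recency (flat (α ∷ βs)) I
    recI′ = round-end-recency {βs = βs} {done = done} split done⊆ recI
    sat′ : Saturated s (flat (α ∷ βs)) I
    sat′ = round-end-saturated {βs = βs} {done = done} split sat
  islru≤lru {ISLRU} {LRU} {s} isIslru isLru d<s αs α done (v ∷ rem) βs old I L p q hist split uI uL L≤s
    L⊆ I⊆ done⊆ recI recL sat le = combine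
      (step ISLRU s (done ++ old) I α v rest λ _ full → islru-victim {done = done} isIslru d<s hist split uI full)
      (step LRU s (done ++ old) L α v rest λ _ full →
        let z∈ , far = isLru _ (cache-nonempty (<-≤-trans (≤-<-trans z≤n d<s) full)) in z∈ , λ {u} u∈ → far u u∈)
    where
    rest : List Request
    rest = upcoming α rem αs
    grow : ∀ {C h} → C ⊆ h → v ∷ C ⊆ v ∷ h
    grow C⊆ (here eq)  = here eq
    grow C⊆ (there x∈) = there (C⊆ x∈)
    uRem : Unique rem
    uRem = rem-unique {done = v ∷ done} split
    combine :
      ∃₂ (λ I′ m → Step s v (λ z → Furthest (done ++ flat βs) I z × z ∉ done) I I′ m ×
        insertionsFrom ISLRU s (done ++ old) I ((α , v) ∷ rest) ≡ m + insertionsFrom ISLRU s (v ∷ done ++ old) I′ rest) →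
      ∃₂ (λ L′ n → Step s v (Furthest (done ++ old) L) L L′ n ×
        insertionsFrom LRU s (done ++ old) L ((α , v) ∷ rest) ≡ n + insertionsFrom LRU s (v ∷ done ++ old) L′ rest) →
      p + insertionsFrom ISLRU s (done ++ old) I ((α , v) ∷ rest) ≤ q + insertionsFrom LRU s (done ++ old) L ((α , v) ∷ rest)
    combine (I′ , m , stI , eqI) (L′ , n , stL , eqL) = lockstep eqI eqL
      (islru≤lru isIslru isLru d<s αs α (v ∷ done) rem βs old I′ L′ (p + m) (q + n) hist split
        (step-unique stI uI) (step-unique stL uL) (step-length stL proj₁ uL L≤s)
        (grow L⊆ ∘ step-⊆ stL) (grow I⊆ ∘ step-⊆ stI)
        (λ { (here refl) → v∈step stI ; (there x∈) → step-survives stI (done⊆ x∈) λ _ _ (_ , x∉) → x∉ x∈ })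
        (recency-step (step-weaken proj₁ stI) recI) (recency-step stL recL)
        (saturated-step stI (proj₁ ∘ proj₁) uI sat) le′)
      where
      open ≤-Reasoning
      -- ISLRU evicts nothing from the rest of the path. LRU may do so, which only increases its
      -- side.
      le′ : p + m + misses I′ rem ≤ q + n + misses L′ rem
      le′ = begin
        p + m + misses I′ rem    ≡⟨ +-assoc p m _ ⟩
        p + (m + misses I′ rem)  ≤⟨ +-monoʳ-≤ p (misses-step-≤ stI uRem λ v∉I ((z∈ , _) , _) →
                                      islru-spares-path {βs = βs} {done = done} split recI I⊆ done⊆ v∉I z∈) ⟩
        p + misses I (v ∷ rem)   ≤⟨ le ⟩
        q + misses L (v ∷ rem)   ≤⟨ +-monoʳ-≤ q (misses-step-≥ stL uRem (done⇒∉rem {done = v ∷ done} split (here refl))) ⟩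
        q + (n + misses L′ rem)  ≡⟨ +-assoc q n _ ⟨
        q + n + misses L′ rem    ∎

  pay : ∀ {a b a′ b′ m n k k′} → a ≡ m + a′ → b ≡ n + b′ → m + k′ ≤ 2 * n + k →
        a′ ≤ 2 * b′ + k′ → a ≤ 2 * b + k
  pay {a′ = a′} {b′} {m} {n} {k} {k′} refl refl paid le = begin
    m + a′               ≤⟨ +-monoʳ-≤ m le ⟩
    m + (2 * b′ + k′)    ≡⟨ solve 3 (λ m b k → m :+ (con 2 :* b :+ k) := m :+ k :+ con 2 :* b) refl m b′ k′ ⟩
    m + k′ + 2 * b′      ≤⟨ +-monoˡ-≤ (2 * b′) paid ⟩
    2 * n + k + 2 * b′   ≡⟨ solve 3 (λ n k b → con 2 :* n :+ k :+ con 2 :* b := con 2 :* (n :+ b) :+ k) refl n k b′ ⟩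
    2 * (n + b′) + k     ∎
    where
    open ≤-Reasoning
    open +-*-Solver

  -- The adversary may be any policy that evicts cached nodes; the splitting into phases depends on
  -- the requests alone.
  lru-competitive : ∀ {LRU π h} → 1 ≤ h → IsLRU LRU → (∀ σ → ∃ (InCache σ) → InCache σ (π σ)) →
    ∀ rs past L C credit → Phase h past L C credit →
    insertionsFrom LRU (2 * h) past L rs ≤ 2 * insertionsFrom π h past C rs + credit
  lru-competitive h≥1 isLru isLazy [] past L C credit ph = z≤n
  lru-competitive {LRU} {π} {h} h≥1 isLru isLazy ((α , v) ∷ rs) past L C credit ph = combine
    (step LRU (2 * h) past L α v rs λ _ full →
      let z∈ , far = isLru _ (cache-nonempty (<-≤-trans (≤-trans h≥1 (m≤m+n h (h + 0))) full)) in z∈ , λ {u} u∈ → far u u∈)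
    (step π h past C α v rs λ _ full → isLazy _ (cache-nonempty (≤-trans h≥1 full)))
    where
    combine :
      ∃₂ (λ L′ m → Step (2 * h) v (Furthest past L) L L′ m ×
        insertionsFrom LRU (2 * h) past L ((α , v) ∷ rs) ≡ m + insertionsFrom LRU (2 * h) (v ∷ past) L′ rs) →
      ∃₂ (λ C′ n → Step h v (_∈ C) C C′ n ×
        insertionsFrom π h past C ((α , v) ∷ rs) ≡ n + insertionsFrom π h (v ∷ past) C′ rs) →
      insertionsFrom LRU (2 * h) past L ((α , v) ∷ rs) ≤ 2 * insertionsFrom π h past C ((α , v) ∷ rs) + credit
    combine (L′ , m , stL , eqL) (C′ , n , stC , eqC) =
      let credit′ , ph′ , paid = phase-step h≥1 stL stC ph in
      pay {b′ = insertionsFrom π h (v ∷ past) C′ rs} {n = n} eqL eqC paid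
        (lru-competitive {LRU} {π} h≥1 isLru isLazy rs (v ∷ past) L′ C′ credit′ ph′)

  -- The inductions start inside a translation, so the empty sequence is treated apart.
  insertions-mono : ∀ {π π′ s} αs →
    (∀ α αs → insertionsFrom π s [] [] (upcoming α (path α) αs) ≤ insertionsFrom π′ s [] [] (upcoming α (path α) αs)) →
    insertions π s αs ≤ insertions π′ s αs
  insertions-mono [] _ = z≤n
  insertions-mono (α ∷ αs) le = le α αs

theorem5p15 : ∀ (K P d : ℕ) (K≥2 : 2 ≤ K) (P≥1 : 1 ≤ P) (d≥1 : 1 ≤ d) →
    let open Translation K P d K≥2 P≥1 in
    ∀ (W : ℕ) → 0 < W → 2 ∣ W → d < W / 2 →
    ∀ (αs : List Address) →
    ∀ (MIN ISMIN ISLRU LRU : Policy) →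
    IsMIN MIN → IsISMIN ISMIN → IsISLRU ISLRU → IsLRU LRU →
    (insertions MIN W αs ≤ insertions ISMIN W αs) ×
    (insertions ISMIN W αs ≤ insertions ISLRU W αs) ×
    (insertions ISLRU W αs ≤ insertions LRU W αs) ×
    (insertions LRU W αs ≤ 2 * insertions MIN (W / 2) αs)
theorem5p15 K P d K≥2 P≥1 d≥1 W _ 2∣W d<W/2 αs MIN ISMIN ISLRU LRU isMin isIsmin isIslru isLru =
  insertions-mono {MIN} {ISMIN} αs (λ α αs → drop-+0
    (min≤ismin {MIN} {ISMIN} isMin isIsmin d<W αs α [] (path α) [] [] [] 0 refl [] [] z≤n (λ _ → z≤n))) ,
  insertions-mono {ISMIN} {ISLRU} αs (λ α αs → drop-+0
    (ismin≤islru {ISMIN} {ISLRU} isIsmin isIslru d<W αs α [] (path α) [] [] [] [] 0 [] refl [] [] z≤n (λ ()) (λ _ → z≤n))) ,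
  insertions-mono {ISLRU} {LRU} αs (λ α αs →
    islru≤lru {ISLRU} {LRU} isIslru isLru d<W αs α [] (path α) [] [] [] [] 0 0 [] refl [] [] z≤n
      (λ ()) (λ ()) (λ ()) (λ ()) (λ ()) (inj₂ λ ()) ≤-refl) ,
  -- The competitive bound concerns the size `2 * (W / 2)`, which is `W` as `W` is even.
  subst (λ w → insertions LRU w αs ≤ 2 * insertions MIN (W / 2) αs) 2*[W/2]≡W
    (drop-+0
      (lru-competitive {LRU} {MIN} (≤-trans d≥1 (<⇒≤ d<W/2)) isLru (λ σ nonempty → proj₁ (isMin σ nonempty))
        (requests αs) [] [] [] 0 record
        { recent = [] ; older = [] ; uniqueL = [] ; uniqueC = [] ; C≤h = z≤n ; unique = [] ; recent≤2h = z≤n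
        ; recent⊆L = λ () ; latest = λ () ; covered = λ () ; older≤ = z≤n ; bound = z≤n }))
  where
  open Translation K P d K≥2 P≥1 hiding (delay)
  open Caching K P d K≥2 P≥1
  drop-+0 : ∀ {m n} → m ≤ n + 0 → m ≤ n
  drop-+0 {m} {n} = subst (m ≤_) (+-identityʳ n)
  2*[W/2]≡W : 2 * (W / 2) ≡ W
  2*[W/2]≡W = DivMod.m*[n/m]≡n 2∣W
  d<W : d < W
  d<W = <-≤-trans d<W/2 (DivMod.m/n≤m W 2)
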